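{- We have $$\sum_{\pi\in\overline{\mathcal P}}y^{e(\pi)}z^{o(\pi)}q^{|\pi|}=\frac{\mathcal J(y,z;q)}{\mathcal J(-y,-z;q)},$$ where $\overline{\mathcal P}$ is the set of all overpartitions, $e(\pi)$ and $o(\pi)$ are the numbers of even and odd parts of $\pi$, and $\mathcal J(y,z;q)=\sum_{\lambda}y^{r(\lambda)}z^{s(\lambda)}q^{|\lambda|}$, the sum being over all integer partitions $\lambda$.
   Context: An overpartition is a partition in which the first occurrence of each distinct part may be overlined. For an overpartition $\pi$, $e(\pi)$ and $o(\pi)$ count even and odd parts with multiplicity and independently of overlining. For an integer partition $\lambda$, let $r(\lambda)$ be the largest part size of multiplicity at least $2$ ($r(\lambda)=0$ if $\lambda$ has distinct parts). Let $u_1>u_2>\cdots$ be the part sizes occurring with odd multiplicity, each taken once (the unpaired parts left after pairing equal parts as far as possible), and let $s(\lambda)=u_1-u_2+u_3-u_4+\cdots$ ($0$ if there are none). The identity is between formal power series in $q$ with coefficients polynomial in $y,z$. -}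

module Defs where

open import Algebra.Bundles using (CommutativeRing)
import Algebra.Properties.CommutativeMonoid.Sum as FinSum
import Algebra.Properties.Semiring.Exp as Exp
open import Data.Bool.Base using (Bool; true; false; T; if_then_else_)
open import Data.Fin.Base as Fin using (toℕ)
open import Data.Integer.Base as ℤ using (ℤ; 0ℤ; 1ℤ)
import Data.Integer.Properties as ℤₚ
open import Data.Integer.Solver using (module +-*-Solver)
open import Data.List.Base
  using (List; []; _∷_; _++_; [_]; map; foldr; filter; length; deduplicate;
         cartesianProduct; cartesianProductWith; applyUpTo)
open import Data.List.Extrema.Nat using (max)
open import Data.List.Membership.Propositional using (_∈_)
open import Data.List.Membership.Propositional.Properties
  using (∈-filter⁺; ∈-filter⁻; ∈-applyUpTo⁺; ∈-cartesianProduct⁺; ∈-cartesianProductWith⁺;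
         ∈-cartesianProductWith⁻)
import Data.List.Properties as List
open import Data.List.Relation.Unary.All as All using (All; []; _∷_)
import Data.List.Relation.Unary.All.Properties as All
open import Data.List.Relation.Unary.AllPairs as AllPairs using (AllPairs; []; _∷_)
import Data.List.Relation.Unary.AllPairs.Properties as AllPairs
open import Data.List.Relation.Unary.Any using (here; there)
open import Data.List.Relation.Unary.Linked as Linked using (Linked)
import Data.List.Relation.Unary.Linked.Properties as Linked
open import Data.List.Relation.Unary.Unique.DecPropositional.Properties using (deduplicate-!)
open import Data.List.Relation.Unary.Unique.Propositional using (Unique)
import Data.List.Relation.Unary.Unique.Propositional.Properties as Unique
open import Data.Nat.Base as ℕ using (ℕ; zero; suc; _∸_; _≤_; _<_; _≥_; z≤n; s≤s)
open import Data.Nat.Divisibility using (_∣?_)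
open import Data.Nat.ListAction using (sum)
import Data.Nat.Properties as ℕₚ
open import Data.Product.Base using (_×_; _,_; proj₁; proj₂; ∃-syntax)
import Data.Product.Properties as Product
open import Data.Sum.Base using (_⊎_; inj₁; inj₂)
open import Function.Base using (_∘_)
open import Function.Bundles using (_⇔_; mk⇔)
open import Level using (0ℓ)
open import Relation.Binary.Core using (Rel)
import Relation.Binary.Definitions as Binary
open import Relation.Binary.PropositionalEquality
  using (_≡_; _≢_; refl; sym; trans; cong; cong₂; subst; module ≡-Reasoning)
import Relation.Binary.Reasoning.Setoid as SetoidReasoning
open import Relation.Nullary using (yes; no; does; ¬?; contradiction; _×-dec_; _→-dec_)
open import Relation.Nullary.Decidable using (T?)
import Relation.Unary as Unary

wordsUpTo : {A : Set} → ℕ → List A → List (List A)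
wordsUpTo zero    as = [ [] ]
wordsUpTo (suc n) as = [] ∷ cartesianProductWith _∷_ as (wordsUpTo n as)

∈-wordsUpTo : {A : Set} {as : List A} (n : ℕ) {w : List A} →
              length w ≤ n → All (_∈ as) w → w ∈ wordsUpTo n as
∈-wordsUpTo zero    {[]}    _       _          = here refl
∈-wordsUpTo (suc n) {[]}    _       _          = here refl
∈-wordsUpTo (suc n) {_ ∷ _} (s≤s l) (a∈ ∷ w∈) =
  there (∈-cartesianProductWith⁺ _∷_ a∈ (∈-wordsUpTo n l w∈))

wordsUpTo-unique : {A : Set} {as : List A} (n : ℕ) → Unique as → Unique (wordsUpTo n as)
wordsUpTo-unique zero             as! = [] ∷ []
wordsUpTo-unique {A} {as} (suc n) as! =
  All.tabulate []≢ ∷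
  Unique.cartesianProductWith⁺ _∷_ List.∷-injective as! (wordsUpTo-unique n as!)
  where
  []≢ : {w : List A} → w ∈ cartesianProductWith _∷_ as (wordsUpTo n as) → [] ≢ w
  []≢ w∈ refl with ∈-cartesianProductWith⁻ _∷_ as (wordsUpTo n as) w∈
  ... | _ , _ , _ , _ , ()

IsPartition : ℕ → List ℕ → Set
IsPartition n ps = All (0 <_) ps × Linked _≥_ ps × sum ps ≡ n

isPartition? : (n : ℕ) → Unary.Decidable (IsPartition n)
isPartition? n ps =
  All.all? (0 ℕₚ.<?_) ps ×-dec Linked.linked? ℕₚ._≥?_ ps ×-dec sum ps ℕₚ.≟ n

-- A partition of n has at most n parts, each between 1 and n.
partitions : ℕ → List (List ℕ)
partitions n = filter (isPartition? n) (wordsUpTo n (applyUpTo suc n))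

multiplicity : ℕ → List ℕ → ℕ
multiplicity k ps = length (filter (k ℕₚ.≟_) ps)

r : List ℕ → ℕ
r ps = max 0 (filter (λ k → 2 ℕₚ.≤? multiplicity k ps) ps)

-- The part sizes u₁ > u₂ > ⋯ of odd multiplicity; ps is weakly decreasing and
-- deduplication keeps the order.
unpaired : List ℕ → List ℕ
unpaired ps = filter (λ k → ¬? (2 ∣? multiplicity k ps)) (deduplicate ℕₚ._≟_ ps)

-- u₁ - (u₂ - (u₃ - ⋯)). Truncated subtraction never truncates on a decreasing list;
-- see unpaired-decreasing and alternatingSum-ℤ.
alternatingSum : List ℕ → ℕ
alternatingSum = foldr _∸_ 0

s : List ℕ → ℕ
s ps = alternatingSum (unpaired ps)

-- (k , true) is an overlined part of size k.
Part : Set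
Part = ℕ × Bool

-- In a weakly decreasing sequence a part is the first occurrence of its size exactly
-- when the preceding part is strictly larger.
_⊵_ : Rel Part 0ℓ
(j , _) ⊵ (k , overlined) = j ≥ k × (T overlined → j ℕ.> k)

_⊵?_ : Binary.Decidable _⊵_
(j , _) ⊵? (k , overlined) = j ℕₚ.≥? k ×-dec (T? overlined →-dec j ℕₚ.>? k)

sizes : List Part → List ℕ
sizes = map proj₁

IsOverpartition : ℕ → List Part → Set
IsOverpartition n π = All (0 <_) (sizes π) × Linked _⊵_ π × sum (sizes π) ≡ n

isOverpartition? : (n : ℕ) → Unary.Decidable (IsOverpartition n)
isOverpartition? n π =
  All.all? (0 ℕₚ.<?_) (sizes π) ×-dec Linked.linked? _⊵?_ π ×-dec sum (sizes π) ℕₚ.≟ n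

overpartitions : ℕ → List (List Part)
overpartitions n =
  filter (isOverpartition? n)
         (wordsUpTo n (cartesianProduct (applyUpTo suc n) (true ∷ false ∷ [])))

e o : List Part → ℕ
e π = length (filter (2 ∣?_) (sizes π))
o π = length (filter (λ k → ¬? (2 ∣? k)) (sizes π))

length≤sum : {ps : List ℕ} → All (0 <_) ps → length ps ≤ sum ps
length≤sum []         = z≤n
length≤sum (0<p ∷ 0<) = ℕₚ.+-mono-≤ 0<p (length≤sum 0<)

parts∈ : {ps : List ℕ} {n : ℕ} → All (0 <_) ps → sum ps ≤ n → All (_∈ applyUpTo suc n) ps
parts∈ []                         _   = []
parts∈ {suc p ∷ ps} (s≤s _ ∷ 0<) s≤n =
  ∈-applyUpTo⁺ suc (ℕₚ.m+n≤o⇒m≤o (suc p) s≤n) ∷ parts∈ 0< (ℕₚ.m+n≤o⇒n≤o (suc p) s≤n)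

∈-partitions : (n : ℕ) (ps : List ℕ) → ps ∈ partitions n ⇔ IsPartition n ps
∈-partitions n ps = mk⇔ to from
  where
  to : ps ∈ partitions n → IsPartition n ps
  to ps∈ = proj₂ (∈-filter⁻ (isPartition? n) {xs = wordsUpTo n (applyUpTo suc n)} ps∈)

  from : IsPartition n ps → ps ∈ partitions n
  from p@(0< , _ , refl) =
    ∈-filter⁺ (isPartition? n)
      (∈-wordsUpTo n (length≤sum 0<) (parts∈ 0< ℕₚ.≤-refl)) p

applyUpTo-suc-unique : (n : ℕ) → Unique (applyUpTo suc n)
applyUpTo-suc-unique n =
  Unique.applyUpTo⁺₁ suc n (λ i<j _ eq → ℕₚ.<⇒≢ i<j (ℕₚ.suc-injective eq))

partitions-unique : (n : ℕ) → Unique (partitions n)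
partitions-unique n =
  Unique.filter⁺ (isPartition? n) (wordsUpTo-unique n (applyUpTo-suc-unique n))

∈-overpartitions : (n : ℕ) (π : List Part) → π ∈ overpartitions n ⇔ IsOverpartition n π
∈-overpartitions n π = mk⇔ to from
  where
  alphabet : List Part
  alphabet = cartesianProduct (applyUpTo suc n) (true ∷ false ∷ [])

  to : π ∈ overpartitions n → IsOverpartition n π
  to π∈ = proj₂ (∈-filter⁻ (isOverpartition? n) {xs = wordsUpTo n alphabet} π∈)

  mark∈ : (b : Bool) → b ∈ (true ∷ false ∷ [])
  mark∈ true  = here refl
  mark∈ false = there (here refl)

  marked∈ : {ρ : List Part} → All (_∈ applyUpTo suc n) (sizes ρ) → All (_∈ alphabet) ρ
  marked∈ {[]}           []       = []
  marked∈ {(_ , b) ∷ _} (k∈ ∷ ∈) = ∈-cartesianProduct⁺ k∈ (mark∈ b) ∷ marked∈ ∈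

  from : IsOverpartition n π → π ∈ overpartitions n
  from p@(0< , _ , refl) =
    ∈-filter⁺ (isOverpartition? n)
      (∈-wordsUpTo n
        (subst (_≤ n) (List.length-map proj₁ π) (length≤sum 0<))
        (marked∈ (parts∈ 0< ℕₚ.≤-refl)))
      p

overpartitions-unique : (n : ℕ) → Unique (overpartitions n)
overpartitions-unique n =
  Unique.filter⁺ (isOverpartition? n)
    (wordsUpTo-unique n
      (Unique.cartesianProduct⁺ (applyUpTo-suc-unique n)
        (((λ ()) ∷ []) ∷ [] ∷ [])))

unpaired-decreasing : {n : ℕ} (ps : List ℕ) → IsPartition n ps → Linked ℕ._>_ (unpaired ps)
unpaired-decreasing ps (_ , ps≥ , _) = Linked.AllPairs⇒Linked
  (AllPairs.filter⁺ (λ k → ¬? (2 ∣? multiplicity k ps))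
    (AllPairs.zipWith (λ (j≥k , j≢k) → ℕₚ.≤∧≢⇒< j≥k (j≢k ∘ sym))
      ( deduplicate⁺ (Linked.Linked⇒AllPairs (λ j≥k k≥l → ℕₚ.≤-trans k≥l j≥k) ps≥)
      , deduplicate-! ℕₚ._≟_ ps)))
  where
  deduplicate⁺ : {qs : List ℕ} → AllPairs _≥_ qs → AllPairs _≥_ (deduplicate ℕₚ._≟_ qs)
  deduplicate⁺ []                 = []
  deduplicate⁺ {q ∷ _} (≥q ∷ qs≥) =
    All.filter⁺ (λ k → ¬? (q ℕₚ.≟ k)) (All.deduplicate⁺ ℕₚ._≟_ ≥q) ∷
    AllPairs.filter⁺ (λ k → ¬? (q ℕₚ.≟ k)) (deduplicate⁺ qs≥)

alternatingSum-≤ : {u : ℕ} {us : List ℕ} → Linked ℕ._>_ (u ∷ us) → alternatingSum us ≤ u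
alternatingSum-≤ {us = []}     _                   = z≤n
alternatingSum-≤ {us = v ∷ us} (v<u Linked.∷ us>) =
  ℕₚ.≤-trans (ℕₚ.m∸n≤m v (alternatingSum us)) (ℕₚ.<⇒≤ v<u)

alternatingSum-ℤ : {us : List ℕ} → Linked ℕ._>_ us →
                   ℤ.+ alternatingSum us ≡ foldr (λ u a → ℤ.+ u ℤ.- a) 0ℤ us
alternatingSum-ℤ {[]}     _   = refl
alternatingSum-ℤ {u ∷ us} us> = begin
  ℤ.+ (u ∸ alternatingSum us)          ≡⟨ ℤₚ.⊖-≥ (alternatingSum-≤ us>) ⟨
  u ℤ.⊖ alternatingSum us              ≡⟨ ℤₚ.m-n≡m⊖n u (alternatingSum us) ⟨
  ℤ.+ u ℤ.- ℤ.+ alternatingSum us      ≡⟨ cong (λ a → ℤ.+ u ℤ.- a) (alternatingSum-ℤ (Linked.tail us>)) ⟩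
  ℤ.+ u ℤ.- foldr (λ u a → ℤ.+ u ℤ.- a) 0ℤ us ∎
  where open ≡-Reasoning

module PowerSeries {c ℓ} (R : CommutativeRing c ℓ) where
  open CommutativeRing R
    hiding (zero) renaming (refl to ≈-refl; sym to ≈-sym; trans to ≈-trans)
  open FinSum +-commutativeMonoid using (sum-syntax)
  open SetoidReasoning setoid

  Series : Set c
  Series = ℕ → Carrier

  infix 4 _≋_
  _≋_ : Rel Series ℓ
  f ≋ g = ∀ n → f n ≈ g n

  infixl 7 _⊛_
  _⊛_ : Series → Series → Series
  (f ⊛ g) n = ∑[ k < suc n ] (f (toℕ k) * g (n ∸ toℕ k))

  -- Long division: if h = f / g and g has constant coefficient 1 then h 0 = f 0, and
  -- (h - h 0) / q is the quotient of (f - h 0 · g) / q by g.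
  infix 7 _/_⟨_⟩
  _/_⟨_⟩ : (f g : Series) → g 0 ≈ 1# → Series
  (f / g ⟨ g₀≈1 ⟩) zero    = f 0
  (f / g ⟨ g₀≈1 ⟩) (suc n) = ((λ k → f (suc k) - f 0 * g (suc k)) / g ⟨ g₀≈1 ⟩) n

  x+[y-x]≈y : ∀ x y → x + (y - x) ≈ y
  x+[y-x]≈y x y = begin
    x + (y - x)   ≈⟨ +-congˡ (+-comm y (- x)) ⟩
    x + (- x + y) ≈⟨ +-assoc x (- x) y ⟨
    (x - x) + y   ≈⟨ +-congʳ (-‿inverseʳ x) ⟩
    0# + y        ≈⟨ +-identityˡ y ⟩
    y             ∎

  [x+y]-x≈y : ∀ x y → (x + y) - x ≈ y
  [x+y]-x≈y x y = begin
    (x + y) - x   ≈⟨ +-assoc x y (- x) ⟩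
    x + (y - x)   ≈⟨ x+[y-x]≈y x y ⟩
    y             ∎

  x*1+0≈x : ∀ x {g} → g ≈ 1# → x * g + 0# ≈ x
  x*1+0≈x x {g} g≈1 = begin
    x * g + 0# ≈⟨ +-identityʳ (x * g) ⟩
    x * g      ≈⟨ *-congˡ g≈1 ⟩
    x * 1#     ≈⟨ *-identityʳ x ⟩
    x          ∎

  /-⊛-inverse : ∀ f g (g₀≈1 : g 0 ≈ 1#) → (f / g ⟨ g₀≈1 ⟩) ⊛ g ≋ f
  /-⊛-inverse f g g₀≈1 zero    = x*1+0≈x (f 0) g₀≈1
  /-⊛-inverse f g g₀≈1 (suc n) = begin
    f 0 * g (suc n) + ((f′ / g ⟨ g₀≈1 ⟩) ⊛ g) n       ≈⟨ +-congˡ (/-⊛-inverse f′ g g₀≈1 n) ⟩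
    f 0 * g (suc n) + (f (suc n) - f 0 * g (suc n))   ≈⟨ x+[y-x]≈y _ _ ⟩
    f (suc n)                                         ∎
    where
    f′ : Series
    f′ k = f (suc k) - f 0 * g (suc k)

  /-unique : ∀ f g (g₀≈1 : g 0 ≈ 1#) h → h ⊛ g ≋ f → h ≋ f / g ⟨ g₀≈1 ⟩
  /-unique f g g₀≈1 h hg≋f zero    = ≈-trans (≈-sym (x*1+0≈x (h 0) g₀≈1)) (hg≋f 0)
  /-unique f g g₀≈1 h hg≋f (suc n) = /-unique f′ g g₀≈1 (h ∘ suc) tail n
    where
    f′ : Series
    f′ k = f (suc k) - f 0 * g (suc k)

    tail : (h ∘ suc) ⊛ g ≋ f′
    tail k = begin
      ((h ∘ suc) ⊛ g) k
        ≈⟨ [x+y]-x≈y (h 0 * g (suc k)) _ ⟨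
      (h ⊛ g) (suc k) - h 0 * g (suc k)
        ≈⟨ +-cong (hg≋f (suc k)) (-‿cong (*-congʳ (/-unique f g g₀≈1 h hg≋f zero))) ⟩
      f′ k ∎

module GeneratingFunctions {c ℓ} (R : CommutativeRing c ℓ) where
  open CommutativeRing R
    hiding (zero) renaming (refl to ≈-refl; sym to ≈-sym; trans to ≈-trans)
  open Exp semiring using (_^_)
  open PowerSeries R

  sumOver : {A : Set} → List A → (A → Carrier) → Carrier
  sumOver xs f = foldr (λ x acc → f x + acc) 0# xs

  𝒥 : Carrier → Carrier → Series
  𝒥 y z n = sumOver (partitions n) λ ps → y ^ r ps * z ^ s ps

  overpartitionSeries : Carrier → Carrier → Series
  overpartitionSeries y z n = sumOver (overpartitions n) λ π → y ^ e π * z ^ o π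

  𝒥₀≈1 : ∀ y z → 𝒥 y z 0 ≈ 1#
  𝒥₀≈1 y z = ≈-trans (+-identityʳ (1# * 1#)) (*-identityʳ 1#)

-- (i , j) stands for the monomial yⁱzʲ.
Exponent : Set
Exponent = ℕ × ℕ

_≟ₑ_ : Binary.DecidableEquality Exponent
_≟ₑ_ = Product.≡-dec ℕₚ._≟_ ℕₚ._≟_

_+ₑ_ : Exponent → Exponent → Exponent
(i , j) +ₑ (k , l) = i ℕ.+ k , j ℕ.+ l

Term : Set
Term = ℤ × Exponent

-- A finite formal sum of terms, possibly with repeated exponents; equality is equality
-- of all coefficients.
Poly : Set
Poly = List Term

coeff : Poly → Exponent → ℤ
coeff []            m = 0ℤ
coeff ((a , d) ∷ p) m = (if does (d ≟ₑ m) then a else 0ℤ) ℤ.+ coeff p m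

infix 4 _≈ₚ_
_≈ₚ_ : Rel Poly 0ℓ
p ≈ₚ p′ = ∀ m → coeff p m ≡ coeff p′ m

_·ₜ_ : Term → Term → Term
(a , d) ·ₜ (b , d′) = a ℤ.* b , d +ₑ d′

_*ₚ_ : Poly → Poly → Poly
_*ₚ_ = cartesianProductWith _·ₜ_

-ₚ_ : Poly → Poly
-ₚ_ = map λ (a , d) → ℤ.- a , d

0ₚ 1ₚ y z : Poly
0ₚ = []
1ₚ = [ 1ℤ , (0 , 0) ]
y  = [ 1ℤ , (1 , 0) ]
z  = [ 1ℤ , (0 , 1) ]

private
  ⟪_,_⟫ : Poly → (Exponent → ℤ) → ℤ
  ⟪ []          , φ ⟫ = 0ℤ
  ⟪ (a , d) ∷ p , φ ⟫ = a ℤ.* φ d ℤ.+ ⟪ p , φ ⟫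

  δ : Exponent → Exponent → ℤ
  δ m d = if does (d ≟ₑ m) then 1ℤ else 0ℤ

  coeff-⟪⟫ : ∀ p m → coeff p m ≡ ⟪ p , δ m ⟫
  coeff-⟪⟫ []            m = refl
  coeff-⟪⟫ ((a , d) ∷ p) m = cong₂ ℤ._+_ (lemma (does (d ≟ₑ m))) (coeff-⟪⟫ p m)
    where
    lemma : ∀ b → (if b then a else 0ℤ) ≡ a ℤ.* (if b then 1ℤ else 0ℤ)
    lemma true  = sym (ℤₚ.*-identityʳ a)
    lemma false = sym (ℤₚ.*-zeroʳ a)

  ≈ₚ-from-⟪⟫ : ∀ p q → (∀ φ → ⟪ p , φ ⟫ ≡ ⟪ q , φ ⟫) → p ≈ₚ q
  ≈ₚ-from-⟪⟫ p q eq m = trans (coeff-⟪⟫ p m) (trans (eq (δ m)) (sym (coeff-⟪⟫ q m)))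

  ⟪⟫-cong : ∀ p {φ ψ} → (∀ d → φ d ≡ ψ d) → ⟪ p , φ ⟫ ≡ ⟪ p , ψ ⟫
  ⟪⟫-cong []            eq = refl
  ⟪⟫-cong ((a , d) ∷ p) eq = cong₂ (λ u v → a ℤ.* u ℤ.+ v) (eq d) (⟪⟫-cong p eq)

  ⟪⟫-++ : ∀ p q φ → ⟪ p ++ q , φ ⟫ ≡ ⟪ p , φ ⟫ ℤ.+ ⟪ q , φ ⟫
  ⟪⟫-++ []            q φ = sym (ℤₚ.+-identityˡ _)
  ⟪⟫-++ ((a , d) ∷ p) q φ =
    trans (cong (λ w → a ℤ.* φ d ℤ.+ w) (⟪⟫-++ p q φ)) (sym (ℤₚ.+-assoc (a ℤ.* φ d) _ _))

  ⟪⟫-neg : ∀ p φ → ⟪ -ₚ p , φ ⟫ ≡ ℤ.- ⟪ p , φ ⟫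
  ⟪⟫-neg []            φ = refl
  ⟪⟫-neg ((a , d) ∷ p) φ =
    trans (cong₂ ℤ._+_ (sym (ℤₚ.neg-distribˡ-* a (φ d))) (⟪⟫-neg p φ))
          (sym (ℤₚ.neg-distrib-+ (a ℤ.* φ d) ⟪ p , φ ⟫))

  ⟪⟫-0 : ∀ p → ⟪ p , (λ _ → 0ℤ) ⟫ ≡ 0ℤ
  ⟪⟫-0 []            = refl
  ⟪⟫-0 ((a , d) ∷ p) = cong₂ ℤ._+_ (ℤₚ.*-zeroʳ a) (⟪⟫-0 p)

  ⟪⟫-linear : ∀ p c φ ψ →
              ⟪ p , (λ d → c ℤ.* φ d ℤ.+ ψ d) ⟫ ≡ c ℤ.* ⟪ p , φ ⟫ ℤ.+ ⟪ p , ψ ⟫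
  ⟪⟫-linear []            c φ ψ = sym (trans (ℤₚ.+-identityʳ (c ℤ.* 0ℤ)) (ℤₚ.*-zeroʳ c))
  ⟪⟫-linear ((a , d) ∷ p) c φ ψ =
    trans (cong (λ w → a ℤ.* (c ℤ.* φ d ℤ.+ ψ d) ℤ.+ w) (⟪⟫-linear p c φ ψ))
          (rearrange a c (φ d) (ψ d) ⟪ p , φ ⟫ ⟪ p , ψ ⟫)
    where
    rearrange : ∀ a c u v P Q →
      a ℤ.* (c ℤ.* u ℤ.+ v) ℤ.+ (c ℤ.* P ℤ.+ Q) ≡
      c ℤ.* (a ℤ.* u ℤ.+ P) ℤ.+ (a ℤ.* v ℤ.+ Q)
    rearrange = solve 6 (λ a c u v P Q →
      a :* (c :* u :+ v) :+ (c :* P :+ Q) := c :* (a :* u :+ P) :+ (a :* v :+ Q)) refl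
      where open +-*-Solver

  ⟪⟫-map : ∀ a d q φ → ⟪ map ((a , d) ·ₜ_) q , φ ⟫ ≡ a ℤ.* ⟪ q , φ ∘ (d +ₑ_) ⟫
  ⟪⟫-map a d []            φ = sym (ℤₚ.*-zeroʳ a)
  ⟪⟫-map a d ((b , f) ∷ q) φ =
    trans (cong₂ ℤ._+_ (ℤₚ.*-assoc a b (φ (d +ₑ f))) (⟪⟫-map a d q φ))
          (sym (ℤₚ.*-distribˡ-+ a (b ℤ.* φ (d +ₑ f)) _))

  ⟪⟫-* : ∀ p q φ → ⟪ p *ₚ q , φ ⟫ ≡ ⟪ p , (λ d → ⟪ q , φ ∘ (d +ₑ_) ⟫) ⟫
  ⟪⟫-* []            q φ = refl
  ⟪⟫-* ((a , d) ∷ p) q φ =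
    trans (⟪⟫-++ (map ((a , d) ·ₜ_) q) (p *ₚ q) φ)
          (cong₂ ℤ._+_ (⟪⟫-map a d q φ) (⟪⟫-* p q φ))

  ⟪⟫-swap : ∀ p q (φ : Exponent → Exponent → ℤ) →
            ⟪ p , (λ d → ⟪ q , φ d ⟫) ⟫ ≡ ⟪ q , (λ f → ⟪ p , (λ d → φ d f) ⟫) ⟫
  ⟪⟫-swap []            q φ = sym (⟪⟫-0 q)
  ⟪⟫-swap ((a , d) ∷ p) q φ =
    trans (cong (λ w → a ℤ.* ⟪ q , φ d ⟫ ℤ.+ w) (⟪⟫-swap p q φ)) (sym (⟪⟫-linear q a (φ d) _))

  +ₑ-comm : ∀ d f → d +ₑ f ≡ f +ₑ d
  +ₑ-comm (i , j) (k , l) = cong₂ _,_ (ℕₚ.+-comm i k) (ℕₚ.+-comm j l)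

  +ₑ-assoc : ∀ d f g → (d +ₑ f) +ₑ g ≡ d +ₑ (f +ₑ g)
  +ₑ-assoc (i , j) (k , l) (m , n) = cong₂ _,_ (ℕₚ.+-assoc i k m) (ℕₚ.+-assoc j l n)

  δ-shift : ∀ m d → (∃[ m′ ] ∀ f → δ m (d +ₑ f) ≡ δ m′ f) ⊎ (∀ f → δ m (d +ₑ f) ≡ 0ℤ)
  δ-shift (i , j) (k , l) with k ℕₚ.≤? i | l ℕₚ.≤? j
  ... | yes k≤i | yes l≤j = inj₁ ((i ∸ k , j ∸ l) , eq)
    where
    eq : ∀ f → δ (i , j) ((k , l) +ₑ f) ≡ δ (i ∸ k , j ∸ l) f
    eq (a , b) with ((k , l) +ₑ (a , b)) ≟ₑ (i , j) | (a , b) ≟ₑ (i ∸ k , j ∸ l)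
    ... | yes _    | yes _    = refl
    ... | no _     | no _     = refl
    ... | yes refl | no ≢     =
      contradiction (cong₂ _,_ (sym (ℕₚ.m+n∸m≡n k a)) (sym (ℕₚ.m+n∸m≡n l b))) ≢
    ... | no ≢     | yes refl =
      contradiction (cong₂ _,_ (ℕₚ.m+[n∸m]≡n k≤i) (ℕₚ.m+[n∸m]≡n l≤j)) ≢
  ... | no k≰i  | _       = inj₂ eq
    where
    eq : ∀ f → δ (i , j) ((k , l) +ₑ f) ≡ 0ℤ
    eq (a , b) with ((k , l) +ₑ (a , b)) ≟ₑ (i , j)
    ... | yes refl = contradiction (ℕₚ.m≤m+n k a) k≰i
    ... | no _     = refl
  ... | yes _   | no l≰j  = inj₂ eq
    where
    eq : ∀ f → δ (i , j) ((k , l) +ₑ f) ≡ 0ℤ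
    eq (a , b) with ((k , l) +ₑ (a , b)) ≟ₑ (i , j)
    ... | yes refl = contradiction (ℕₚ.m≤m+n l b) l≰j
    ... | no _     = refl

  ⟪⟫-δ-shift : ∀ q q′ m d → q ≈ₚ q′ → ⟪ q , δ m ∘ (d +ₑ_) ⟫ ≡ ⟪ q′ , δ m ∘ (d +ₑ_) ⟫
  ⟪⟫-δ-shift q q′ m d q≈q′ with δ-shift m d
  ... | inj₁ (m′ , eq) = begin
    ⟪ q  , δ m ∘ (d +ₑ_) ⟫ ≡⟨ ⟪⟫-cong q eq ⟩
    ⟪ q  , δ m′ ⟫          ≡⟨ coeff-⟪⟫ q m′ ⟨
    coeff q m′             ≡⟨ q≈q′ m′ ⟩
    coeff q′ m′            ≡⟨ coeff-⟪⟫ q′ m′ ⟩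
    ⟪ q′ , δ m′ ⟫          ≡⟨ ⟪⟫-cong q′ eq ⟨
    ⟪ q′ , δ m ∘ (d +ₑ_) ⟫ ∎
    where open ≡-Reasoning
  ... | inj₂ eq =
    trans (trans (⟪⟫-cong q eq) (⟪⟫-0 q)) (sym (trans (⟪⟫-cong q′ eq) (⟪⟫-0 q′)))

  coeff-++ : ∀ p q m → coeff (p ++ q) m ≡ coeff p m ℤ.+ coeff q m
  coeff-++ []            q m = sym (ℤₚ.+-identityˡ _)
  coeff-++ ((a , d) ∷ p) q m =
    trans (cong (λ w → (if does (d ≟ₑ m) then a else 0ℤ) ℤ.+ w) (coeff-++ p q m))
          (sym (ℤₚ.+-assoc (if does (d ≟ₑ m) then a else 0ℤ) (coeff p m) (coeff q m)))

  coeff-neg : ∀ p m → coeff (-ₚ p) m ≡ ℤ.- coeff p m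
  coeff-neg p m =
    trans (coeff-⟪⟫ (-ₚ p) m) (trans (⟪⟫-neg p (δ m)) (cong ℤ.-_ (sym (coeff-⟪⟫ p m))))

  +ₚ-cong : ∀ p p′ q q′ → p ≈ₚ p′ → q ≈ₚ q′ → (p ++ q) ≈ₚ (p′ ++ q′)
  +ₚ-cong p p′ q q′ p≈ q≈ m =
    trans (coeff-++ p q m) (trans (cong₂ ℤ._+_ (p≈ m) (q≈ m)) (sym (coeff-++ p′ q′ m)))

  +ₚ-comm : ∀ p q → (p ++ q) ≈ₚ (q ++ p)
  +ₚ-comm p q m =
    trans (coeff-++ p q m)
          (trans (ℤₚ.+-comm (coeff p m) (coeff q m)) (sym (coeff-++ q p m)))

  -ₚ-inverseˡ : ∀ p → (-ₚ p ++ p) ≈ₚ 0ₚ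
  -ₚ-inverseˡ p m =
    trans (coeff-++ (-ₚ p) p m)
          (trans (cong (ℤ._+ coeff p m) (coeff-neg p m)) (ℤₚ.+-inverseˡ (coeff p m)))

  -ₚ-cong : ∀ p q → p ≈ₚ q → (-ₚ p) ≈ₚ (-ₚ q)
  -ₚ-cong p q p≈q m =
    trans (coeff-neg p m) (trans (cong ℤ.-_ (p≈q m)) (sym (coeff-neg q m)))

  *ₚ-comm : ∀ p q → (p *ₚ q) ≈ₚ (q *ₚ p)
  *ₚ-comm p q = ≈ₚ-from-⟪⟫ (p *ₚ q) (q *ₚ p) λ φ → begin
    ⟪ p *ₚ q , φ ⟫                             ≡⟨ ⟪⟫-* p q φ ⟩
    ⟪ p , (λ d → ⟪ q , (λ f → φ (d +ₑ f)) ⟫) ⟫ ≡⟨ ⟪⟫-swap p q (λ d f → φ (d +ₑ f)) ⟩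
    ⟪ q , (λ f → ⟪ p , (λ d → φ (d +ₑ f)) ⟫) ⟫ ≡⟨ ⟪⟫-cong q (λ f → ⟪⟫-cong p (λ d → cong φ (+ₑ-comm d f))) ⟩
    ⟪ q , (λ f → ⟪ p , (λ d → φ (f +ₑ d)) ⟫) ⟫ ≡⟨ ⟪⟫-* q p φ ⟨
    ⟪ q *ₚ p , φ ⟫                             ∎
    where open ≡-Reasoning

  *ₚ-assoc : ∀ p q t → ((p *ₚ q) *ₚ t) ≈ₚ (p *ₚ (q *ₚ t))
  *ₚ-assoc p q t = ≈ₚ-from-⟪⟫ ((p *ₚ q) *ₚ t) (p *ₚ (q *ₚ t)) λ φ → begin
    ⟪ (p *ₚ q) *ₚ t , φ ⟫
      ≡⟨ ⟪⟫-* (p *ₚ q) t φ ⟩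
    ⟪ p *ₚ q , (λ d → ⟪ t , φ ∘ (d +ₑ_) ⟫) ⟫
      ≡⟨ ⟪⟫-* p q _ ⟩
    ⟪ p , (λ d → ⟪ q , (λ f → ⟪ t , (λ g → φ ((d +ₑ f) +ₑ g)) ⟫) ⟫) ⟫
      ≡⟨ ⟪⟫-cong p (λ d → ⟪⟫-cong q (λ f → ⟪⟫-cong t (λ g → cong φ (+ₑ-assoc d f g)))) ⟩
    ⟪ p , (λ d → ⟪ q , (λ f → ⟪ t , (λ g → φ (d +ₑ (f +ₑ g))) ⟫) ⟫) ⟫
      ≡⟨ ⟪⟫-cong p (λ d → ⟪⟫-* q t (φ ∘ (d +ₑ_))) ⟨
    ⟪ p , (λ d → ⟪ q *ₚ t , φ ∘ (d +ₑ_) ⟫) ⟫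
      ≡⟨ ⟪⟫-* p (q *ₚ t) φ ⟨
    ⟪ p *ₚ (q *ₚ t) , φ ⟫ ∎
    where open ≡-Reasoning

  *ₚ-congˡ : ∀ p q q′ → q ≈ₚ q′ → (p *ₚ q) ≈ₚ (p *ₚ q′)
  *ₚ-congˡ p q q′ q≈q′ m = begin
    coeff (p *ₚ q) m                        ≡⟨ coeff-⟪⟫ (p *ₚ q) m ⟩
    ⟪ p *ₚ q , δ m ⟫                        ≡⟨ ⟪⟫-* p q (δ m) ⟩
    ⟪ p , (λ d → ⟪ q , δ m ∘ (d +ₑ_) ⟫) ⟫  ≡⟨ ⟪⟫-cong p (λ d → ⟪⟫-δ-shift q q′ m d q≈q′) ⟩
    ⟪ p , (λ d → ⟪ q′ , δ m ∘ (d +ₑ_) ⟫) ⟫ ≡⟨ ⟪⟫-* p q′ (δ m) ⟨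
    ⟪ p *ₚ q′ , δ m ⟫                       ≡⟨ coeff-⟪⟫ (p *ₚ q′) m ⟨
    coeff (p *ₚ q′) m                       ∎
    where open ≡-Reasoning

  *ₚ-cong : ∀ p p′ q q′ → p ≈ₚ p′ → q ≈ₚ q′ → (p *ₚ q) ≈ₚ (p′ *ₚ q′)
  *ₚ-cong p p′ q q′ p≈ q≈ m = begin
    coeff (p *ₚ q) m   ≡⟨ *ₚ-congˡ p q q′ q≈ m ⟩
    coeff (p *ₚ q′) m  ≡⟨ *ₚ-comm p q′ m ⟩
    coeff (q′ *ₚ p) m  ≡⟨ *ₚ-congˡ q′ p p′ p≈ m ⟩
    coeff (q′ *ₚ p′) m ≡⟨ *ₚ-comm q′ p′ m ⟩
    coeff (p′ *ₚ q′) m ∎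
    where open ≡-Reasoning

  *ₚ-identityˡ : ∀ p → (1ₚ *ₚ p) ≈ₚ p
  *ₚ-identityˡ p = ≈ₚ-from-⟪⟫ (1ₚ *ₚ p) p λ φ →
    trans (⟪⟫-* 1ₚ p φ) (trans (ℤₚ.+-identityʳ _) (ℤₚ.*-identityˡ ⟪ p , φ ⟫))

  *ₚ-distribʳ : ∀ p q t → ((q ++ t) *ₚ p) ≈ₚ ((q *ₚ p) ++ (t *ₚ p))
  *ₚ-distribʳ p q t = ≈ₚ-from-⟪⟫ ((q ++ t) *ₚ p) ((q *ₚ p) ++ (t *ₚ p)) λ φ → begin
    ⟪ (q ++ t) *ₚ p , φ ⟫                ≡⟨ ⟪⟫-* (q ++ t) p φ ⟩
    ⟪ q ++ t , _ ⟫                       ≡⟨ ⟪⟫-++ q t _ ⟩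
    ⟪ q , _ ⟫ ℤ.+ ⟪ t , _ ⟫              ≡⟨ cong₂ ℤ._+_ (⟪⟫-* q p φ) (⟪⟫-* t p φ) ⟨
    ⟪ q *ₚ p , φ ⟫ ℤ.+ ⟪ t *ₚ p , φ ⟫    ≡⟨ ⟪⟫-++ (q *ₚ p) (t *ₚ p) φ ⟨
    ⟪ (q *ₚ p) ++ (t *ₚ p) , φ ⟫         ∎
    where open ≡-Reasoning

ℤ[y,z] : CommutativeRing 0ℓ 0ℓ
ℤ[y,z] = record
  { Carrier = Poly
  ; _≈_     = _≈ₚ_
  ; _+_     = _++_
  ; _*_     = _*ₚ_
  ; -_      = -ₚ_
  ; 0#      = 0ₚ
  ; 1#      = 1ₚ
  ; isCommutativeRing = record
    { isRing = record
      { +-isAbelianGroup = record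
        { isGroup = record
          { isMonoid = record
            { isSemigroup = record
              { isMagma = record
                { isEquivalence = record
                  { refl  = λ _ → refl
                  ; sym   = λ p≈q m → sym (p≈q m)
                  ; trans = λ p≈q q≈t m → trans (p≈q m) (q≈t m)
                  }
                ; ∙-cong = λ {p} {p′} {q} {q′} → +ₚ-cong p p′ q q′
                }
              ; assoc = λ p q t m → cong (λ u → coeff u m) (List.++-assoc p q t)
              }
            ; identity = (λ _ _ → refl) , λ p m → cong (λ u → coeff u m) (List.++-identityʳ p)
            }
          ; inverse = -ₚ-inverseˡ , λ p m → trans (+ₚ-comm p (-ₚ p) m) (-ₚ-inverseˡ p m)
          ; ⁻¹-cong = λ {p} {q} → -ₚ-cong p q
          }
        ; comm = +ₚ-comm
        }
      ; *-cong     = λ {p} {p′} {q} {q′} → *ₚ-cong p p′ q q′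
      ; *-assoc    = *ₚ-assoc
      ; *-identity = *ₚ-identityˡ , λ p m → trans (*ₚ-comm p 1ₚ m) (*ₚ-identityˡ p m)
      ; distrib    =
          (λ p q t m → trans (*ₚ-comm p (q ++ t) m)
            (trans (*ₚ-distribʳ p q t m)
              (+ₚ-cong (q *ₚ p) (p *ₚ q) (t *ₚ p) (p *ₚ t) (*ₚ-comm q p) (*ₚ-comm t p) m)))
          , *ₚ-distribʳ
      }
    ; *-comm = *ₚ-comm
    }
  }

open PowerSeries ℤ[y,z] public
open GeneratingFunctions ℤ[y,z] public

{-# OPTIONS --safe #-}

module Submission where

open import Algebra.Bundles using (CommutativeRing)
import Algebra.Properties.AbelianGroup as AbelianGroupProperties
import Algebra.Properties.CommutativeSemiring.Exp as ExpProperties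
import Algebra.Properties.Ring as RingProperties
import Algebra.Solver.Ring.NaturalCoefficients.Default as RingSolver
open import Data.Bool.Base using (Bool; true; false; if_then_else_)
open import Data.List.Base using (List; []; _∷_; _++_; [_]; map; filter; length; deduplicate)
open import Data.List.Extrema.Nat using (max; max≈v⁺)
open import Data.List.Membership.Propositional using (_∈_)
open import Data.List.Membership.Propositional.Properties
  using (∈-filter⁺; ∈-filter⁻; ∈-map⁺; ∈-map⁻; ∈-++⁺ˡ; ∈-++⁺ʳ; ∈-++⁻)
open import Data.List.Membership.Propositional.Properties.WithK using (unique∧set⇒bag)
open import Data.List.Properties
  using (∷-injectiveʳ; filter-all; filter-none; filter-accept; filter-reject; filter-idem; filter-≐)
open import Data.List.Relation.Binary.BagAndSetEquality using (∼bag⇒↭)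
open import Data.List.Relation.Binary.Permutation.Propositional as ↭ using (_↭_)
open import Data.List.Relation.Unary.All as All using (All; []; _∷_)
import Data.List.Relation.Unary.All.Properties as All
import Data.List.Relation.Unary.AllPairs as AllPairs
open import Data.List.Relation.Unary.Any using (here; there)
open import Data.List.Relation.Unary.Linked as Linked using (Linked; []; [-]; _∷_)
import Data.List.Relation.Unary.Linked.Properties as Linked
open import Data.List.Relation.Unary.Unique.Propositional using (Unique; []; _∷_)
import Data.List.Relation.Unary.Unique.Propositional.Properties as Unique
open import Data.Nat.Base as ℕ using (ℕ; zero; suc; _∸_; _≤_; _≥_; z≤n; s≤s)
open import Data.Nat.Divisibility
  using (_∣_; _∤_; _∣?_; ∣-refl; _∣0; m∣m*n; ∣m∣n⇒∣m+n; ∣m+n∣m⇒∣n; ∣1⇒≡1)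
open import Data.Nat.ListAction using (sum)
import Data.Nat.Properties as ℕₚ
open import Data.Product.Base using (_×_; _,_; proj₁; proj₂; ∃-syntax)
open import Data.Sum.Base using (_⊎_; inj₁; inj₂)
open import Function.Base using (_∘_)
open import Function.Bundles using (_⇔_; mk⇔; Equivalence)
import Relation.Binary.PropositionalEquality as ≡
open ≡ using (_≡_; _≢_)
import Relation.Binary.Reasoning.Setoid as SetoidReasoning
open import Relation.Nullary using (¬_; yes; no; does; ¬?; contradiction)
open import Relation.Nullary.Decidable using (dec-true; dec-false)
import Relation.Unary as Unary
open import Defs using (module PowerSeries; module GeneratingFunctions)

-- Removing pairs of equal parts splits a partition λ into a partition with all multiplicities
-- even, whose largest part is r(λ), and a partition into distinct parts with alternating
-- sum s(λ). With parts at most m, the first kind contributes Σ_{k≤m} (yq²)ᵏ/(q²;q²)ₖ. Removing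
-- the part m from the second kind replaces s by m - s, and two such steps give the
-- recurrence of the Rogers–Szegő polynomials Σₖ (zq)ᵏ [m choose k]_{q²}. In the limit both
-- families satisfy G(x) = G(q²x) + x G(x), so J(y,z;q) is 1/((yq²;q²)(zq;q²)).
--
-- Let E_m count the overpartitions with parts at most m, let x be yqᵐ or zqᵐ according to the
-- parity of m, and let T be the factor of J(y,z;q) that comes from parts greater than m.
-- Passing from m - 1 to m multiplies E by (1 + x)/(1 - x), T by 1 - x and T(-y,-z) by 1 + x, so
-- E_m J(-y,-z) T = J(y,z) T(-y,-z) persists, and T tends to 1.
--
-- Everything takes place modulo q^{N+1}, where q is nilpotent and no limits are needed.

-- Stated apart so that the nilpotency of `q` can be a module parameter, where the powers of `S` are
-- not yet in scope.
PowerVanishes : ∀ {c ℓ} (S : CommutativeRing c ℓ) → CommutativeRing.Carrier S → ℕ → Set ℓ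
PowerVanishes S q n = q ^ n ≈ 0#
  where
  open CommutativeRing S
  open ExpProperties commutativeSemiring using (_^_)

-- Geometric series in a ring with a nilpotent element

module NilpotentVariable
  {c ℓ} (S : CommutativeRing c ℓ) (q : CommutativeRing.Carrier S)
  (N : ℕ) (q^1+N≈0 : PowerVanishes S q (suc N))
  where

  open CommutativeRing S hiding (zero)
  open ExpProperties commutativeSemiring using (_^_; ^-congˡ; ^-distrib-*; ^-assocʳ)
  open AbelianGroupProperties +-abelianGroup using (∙-cancelʳ)
  open RingSolver commutativeSemiring using (solve; _:=_; _:+_; _:*_; con)
  open SetoidReasoning setoid

  p : Carrier
  p = q * q

  p^≈q^q^ : ∀ m → p ^ m ≈ q ^ m * q ^ m
  p^≈q^q^ m = ^-distrib-* q q m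

  q^[1+N]*≈0 : ∀ a → q ^ suc N * a ≈ 0#
  q^[1+N]*≈0 a = trans (*-congʳ q^1+N≈0) (zeroˡ a)

  multiple-nilpotent : ∀ {k t} → k ≈ q * t → k ^ suc N ≈ 0#
  multiple-nilpotent {k} {t} k≈qt = begin
    k ^ suc N               ≈⟨ ^-congˡ (suc N) k≈qt ⟩
    (q * t) ^ suc N         ≈⟨ ^-distrib-* q t (suc N) ⟩
    q ^ suc N * t ^ suc N   ≈⟨ q^[1+N]*≈0 _ ⟩
    0#                      ∎

  -- The sum f(1 + k + ⋯ + kⁱ) in Horner form. For a multiple k of `q` and i = N it serves as f/(1 -
  -- k).
  geometric : Carrier → Carrier → ℕ → Carrier
  geometric k f zero    = f
  geometric k f (suc i) = f + k * geometric k f i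

  geometric-suc : ∀ k f i → geometric k f (suc i) ≈ geometric k f i + k ^ suc i * f
  geometric-suc k f zero    = +-congˡ (*-congʳ (sym (*-identityʳ k)))
  geometric-suc k f (suc i) = begin
    f + k * geometric k f (suc i)
      ≈⟨ +-congˡ (*-congˡ (geometric-suc k f i)) ⟩
    f + k * (geometric k f i + k ^ suc i * f)
      ≈⟨ solve 4 (λ f k g x → f :+ k :* (g :+ x :* f) := (f :+ k :* g) :+ (k :* x) :* f)
           refl f k (geometric k f i) (k ^ suc i) ⟩
    geometric k f (suc i) + k ^ suc (suc i) * f ∎

  -- The partial sums for N and N + 1 differ by a multiple of k^(N+1) = 0, so the recursion of
  -- `geometric` closes up into an equation for one element.
  geometric-fixed : ∀ {k t} f → k ≈ q * t → geometric k f N ≈ f + k * geometric k f N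
  geometric-fixed {k} f k≈qt = begin
    geometric k f N                       ≈⟨ +-identityʳ _ ⟨
    geometric k f N + 0#                  ≈⟨ +-congˡ (zeroˡ f) ⟨
    geometric k f N + 0# * f              ≈⟨ +-congˡ (*-congʳ (multiple-nilpotent k≈qt)) ⟨
    geometric k f N + k ^ suc N * f       ≈⟨ geometric-suc k f N ⟨
    f + k * geometric k f N               ∎

  geometric-unfold : ∀ {k f x} → x ≈ f + k * x → ∀ i → x ≈ geometric k f i + k ^ suc i * x
  geometric-unfold {k} {f} {x} x≈ zero    = trans x≈ (+-congˡ (*-congʳ (sym (*-identityʳ k))))
  geometric-unfold {k} {f} {x} x≈ (suc i) = begin
    x
      ≈⟨ x≈ ⟩
    f + k * x
      ≈⟨ +-congˡ (*-congˡ (geometric-unfold x≈ i)) ⟩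
    f + k * (geometric k f i + k ^ suc i * x)
      ≈⟨ solve 5 (λ f k g y x → f :+ k :* (g :+ y :* x) := (f :+ k :* g) :+ (k :* y) :* x)
           refl f k (geometric k f i) (k ^ suc i) x ⟩
    geometric k f (suc i) + k ^ suc (suc i) * x ∎

  geometric-unique : ∀ {k t f x} → k ≈ q * t → x ≈ f + k * x → x ≈ geometric k f N
  geometric-unique {k} {t} {f} {x} k≈qt x≈ = begin
    x                                ≈⟨ geometric-unfold x≈ N ⟩
    geometric k f N + k ^ suc N * x  ≈⟨ +-congˡ (*-congʳ (multiple-nilpotent k≈qt)) ⟩
    geometric k f N + 0# * x         ≈⟨ +-congˡ (zeroˡ x) ⟩
    geometric k f N + 0#             ≈⟨ +-identityʳ _ ⟩
    geometric k f N                  ∎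

  -- As k is nilpotent, 1 - k is invertible and x = f + kx determines x. This identifies the
  -- solution of a recurrence with a closed form without dividing.
  fixed-unique : ∀ {k t f x x′} → k ≈ q * t → x ≈ f + k * x → x′ ≈ f + k * x′ → x ≈ x′
  fixed-unique k≈qt x≈ x′≈ = trans (geometric-unique k≈qt x≈) (sym (geometric-unique k≈qt x′≈))

  -- Euler's series and the Rogers-Szegő polynomials

  p^suc≈q* : ∀ m → p ^ suc m ≈ q * (q * p ^ m)
  p^suc≈q* m = *-assoc q q (p ^ m)

  -- 1 / (q²;q²)ₘ
  even : ℕ → Carrier
  even zero    = 1#
  even (suc m) = geometric (p ^ suc m) (even m) N

  even-suc : ∀ m → even (suc m) ≈ even m + p ^ suc m * even (suc m)
  even-suc m = geometric-fixed (even m) (p^suc≈q* m)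

  -- Σ_{k≤m} xᵏ / (q²;q²)ₖ, a partial sum of Euler's expansion of 1 / (x;q²)_∞
  euler : Carrier → ℕ → Carrier
  euler x zero    = 1#
  euler x (suc m) = euler x m + x ^ suc m * even (suc m)

  -- In the term of degree k, the difference between x and q²x is a factor 1 - q²ᵏ, which cancels
  -- the last factor of (q²;q²)ₖ and leaves x times the term of degree k - 1.
  euler-shift : ∀ x m → euler x (suc m) ≈ euler (p * x) (suc m) + x * euler x m
  euler-shift x m = begin
    euler x m + x ^ suc m * even (suc m)
      ≈⟨ +-cong (ih m) (*-congˡ (even-suc m)) ⟩
    (euler (p * x) m + prev m) + x ^ suc m * (even m + p ^ suc m * even (suc m))
      ≈⟨ solve 7 (λ e′ u xm x z pm z′ →
           (e′ :+ u) :+ (x :* xm) :* (z :+ pm :* z′) :=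
           (e′ :+ (pm :* (x :* xm)) :* z′) :+ (u :+ x :* (xm :* z)))
           refl (euler (p * x) m) (prev m) (x ^ m) x (even m) (p ^ suc m) (even (suc m)) ⟩
    (euler (p * x) m + p ^ suc m * x ^ suc m * even (suc m)) + (prev m + x * (x ^ m * even m))
      ≈⟨ +-cong (+-congˡ (*-congʳ (sym (^-distrib-* p x (suc m))))) (step m) ⟩
    euler (p * x) (suc m) + x * euler x m ∎
    where
    -- This is x times the partial sum up to m - 1. The value 0 at m = 0 is the empty sum, which
    -- lets `ih` cover the base case.
    prev : ℕ → Carrier
    prev zero    = 0#
    prev (suc m) = x * euler x m

    ih : ∀ m → euler x m ≈ euler (p * x) m + prev m
    ih zero    = sym (+-identityʳ 1#)
    ih (suc m) = euler-shift x m

    step : ∀ m → prev m + x * (x ^ m * even m) ≈ x * euler x m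
    step zero    = trans (+-identityˡ _) (*-congˡ (*-identityˡ 1#))
    step (suc m) = sym (distribˡ x (euler x m) (x ^ suc m * even (suc m)))

  -- The term of degree N + 1 contains x^(N+1) = 0, so the two upper limits in `euler-shift` may be
  -- made equal.
  euler-fixed : ∀ {x t} → x ≈ q * t → euler x N ≈ euler (p * x) N + x * euler x N
  euler-fixed {x} x≈qt = begin
    euler x N                               ≈⟨ last x≈qt ⟨
    euler x (suc N)                         ≈⟨ euler-shift x N ⟩
    euler (p * x) (suc N) + x * euler x N   ≈⟨ +-congʳ (last (*-assoc q q x)) ⟩
    euler (p * x) N + x * euler x N         ∎
    where
    last : ∀ {x t} → x ≈ q * t → euler x (suc N) ≈ euler x N
    last x≈qt =
      trans (+-congˡ (trans (*-congʳ (multiple-nilpotent x≈qt)) (zeroˡ _))) (+-identityʳ _)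

  euler-0 : ∀ {x} → x ≈ 0# → ∀ m → euler x m ≈ 1#
  euler-0 x≈0 zero    = refl
  euler-0 x≈0 (suc m) = trans
    (+-cong (euler-0 x≈0 m) (trans (*-congʳ (trans (*-congʳ x≈0) (zeroˡ _))) (zeroˡ _)))
    (+-identityʳ 1#)

  -- Σₖ xᵏ [m choose k]_{q²}. The three-term recurrence is split into one for the value and one
  -- for the difference Δ x m between the values at m + 1 and m, so that no subtraction occurs.
  rogersSzegő Δ : Carrier → ℕ → Carrier
  rogersSzegő x zero    = 1#
  rogersSzegő x (suc m) = rogersSzegő x m + Δ x m
  Δ x zero              = x
  Δ x (suc m)           = x * (Δ x m + p ^ suc m * rogersSzegő x m)

  -- Both equations are q-Pascal rules with base q². The first comes from [m+1 choose k] = q²ᵏ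
  -- [m choose k] + [m choose k-1], the second from [m+1 choose k] = [m choose k] + q^(2(m+1-k))
  -- [m choose k-1]. Starting from the three-term recurrence, each needs the other in its induction
  -- step.
  rogersSzegő-shift : ∀ x m → rogersSzegő x (suc m) ≈ rogersSzegő (p * x) m + x * rogersSzegő x m
  Δ-shift           : ∀ x m → Δ (p * x) m ≈ x * (p ^ suc m * rogersSzegő x m)

  rogersSzegő-shift x zero    = +-congˡ (sym (*-identityʳ x))
  rogersSzegő-shift x (suc m) = begin
    rogersSzegő x (suc m) + x * (Δ x m + p ^ suc m * rogersSzegő x m)
      ≈⟨ +-congʳ (rogersSzegő-shift x m) ⟩
    (rogersSzegő (p * x) m + x * rogersSzegő x m) + x * (Δ x m + p ^ suc m * rogersSzegő x m)
      ≈⟨ solve 5 (λ r′ x r d w →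
           (r′ :+ x :* r) :+ x :* (d :+ w) := (r′ :+ x :* w) :+ x :* (r :+ d))
           refl (rogersSzegő (p * x) m) x (rogersSzegő x m) (Δ x m) (p ^ suc m * rogersSzegő x m) ⟩
    (rogersSzegő (p * x) m + x * (p ^ suc m * rogersSzegő x m)) + x * rogersSzegő x (suc m)
      ≈⟨ +-congʳ (+-congˡ (Δ-shift x m)) ⟨
    rogersSzegő (p * x) (suc m) + x * rogersSzegő x (suc m) ∎

  Δ-shift x zero    =
    solve 2 (λ p x → p :* x := x :* ((p :* con 1) :* con 1)) refl p x
  Δ-shift x (suc m) = begin
    p * x * (Δ (p * x) m + p ^ suc m * rogersSzegő (p * x) m)
      ≈⟨ *-congˡ (+-congʳ (Δ-shift x m)) ⟩
    p * x * (x * (p ^ suc m * rogersSzegő x m) + p ^ suc m * rogersSzegő (p * x) m)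
      ≈⟨ solve 5 (λ p x w r r′ →
           p :* x :* (x :* (w :* r) :+ w :* r′) := x :* ((p :* w) :* (r′ :+ x :* r)))
           refl p x (p ^ suc m) (rogersSzegő x m) (rogersSzegő (p * x) m) ⟩
    x * (p ^ suc (suc m) * (rogersSzegő (p * x) m + x * rogersSzegő x m))
      ≈⟨ *-congˡ (*-congˡ (rogersSzegő-shift x m)) ⟨
    x * (p ^ suc (suc m) * rogersSzegő x (suc m)) ∎

  -- Each step of the recurrence contributes one more factor x, hence one more `q`. So `Δ x N`
  -- contains q^(N+1) and vanishes, and the polynomials for N and N + 1 agree.
  Δ-multiple : ∀ {x t} → x ≈ q * t → ∀ m → ∃[ h ] Δ x m ≈ q ^ suc m * h
  Δ-multiple {x} {t} x≈qt zero    = t , trans x≈qt (*-congʳ (sym (*-identityʳ q)))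
  Δ-multiple {x} {t} x≈qt (suc m) with h , Δ≈ ← Δ-multiple x≈qt m =
    t * (h + q ^ suc m * rogersSzegő x m) , (begin
      x * (Δ x m + p ^ suc m * rogersSzegő x m)
        ≈⟨ *-cong x≈qt (+-cong Δ≈ (*-congʳ (p^≈q^q^ (suc m)))) ⟩
      q * t * (q ^ suc m * h + q ^ suc m * q ^ suc m * rogersSzegő x m)
        ≈⟨ solve 5 (λ q t w h r →
             q :* t :* (w :* h :+ w :* w :* r) := (q :* w) :* (t :* (h :+ w :* r)))
             refl q t (q ^ suc m) h (rogersSzegő x m) ⟩
      q ^ suc (suc m) * (t * (h + q ^ suc m * rogersSzegő x m)) ∎)

  rogersSzegő-fixed : ∀ {x t} → x ≈ q * t →
    rogersSzegő x N ≈ rogersSzegő (p * x) N + x * rogersSzegő x N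
  rogersSzegő-fixed {x} x≈qt with h , Δ≈ ← Δ-multiple x≈qt N = begin
    rogersSzegő x N                               ≈⟨ +-identityʳ _ ⟨
    rogersSzegő x N + 0#                          ≈⟨ +-congˡ (trans Δ≈ (q^[1+N]*≈0 h)) ⟨
    rogersSzegő x (suc N)                         ≈⟨ rogersSzegő-shift x N ⟩
    rogersSzegő (p * x) N + x * rogersSzegő x N   ∎

  rogersSzegő-0 : ∀ {x} → x ≈ 0# → ∀ m → rogersSzegő x m ≈ 1#
  rogersSzegő-0 {x} x≈0 zero    = refl
  rogersSzegő-0 {x} x≈0 (suc m) = trans (+-cong (rogersSzegő-0 x≈0 m) (Δ-0 m)) (+-identityʳ 1#)
    where
    Δ-0 : ∀ m → Δ x m ≈ 0#
    Δ-0 zero    = x≈0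
    Δ-0 (suc m) = trans (*-congʳ x≈0) (zeroˡ _)

  -- Partitions into distinct parts, and the factorisation of rank sums

  -- Σ_u φ(alternating sum of u) q^|u| over the partitions u into distinct parts at most m
  distinct : ℕ → (ℕ → Carrier) → Carrier
  distinct zero    φ = φ 0
  distinct (suc m) φ = distinct m φ + q ^ suc m * distinct m (φ ∘ (suc m ∸_))

  -- The alternating sum never exceeds the largest part, so only arguments k ≤ m occur. This bound
  -- is what permits rewriting truncated differences under `distinct`.
  distinct-cong : ∀ m {φ ψ} → (∀ {k} → k ≤ m → φ k ≈ ψ k) → distinct m φ ≈ distinct m ψ
  distinct-cong zero    φ≈ψ = φ≈ψ z≤n
  distinct-cong (suc m) φ≈ψ = +-cong
    (distinct-cong m (φ≈ψ ∘ ℕₚ.m≤n⇒m≤1+n))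
    (*-congˡ (distinct-cong m (λ {k} _ → φ≈ψ (ℕₚ.m∸n≤m (suc m) k))))

  distinct-scale : ∀ m a φ → distinct m (λ k → a * φ k) ≈ a * distinct m φ
  distinct-scale zero    a φ = refl
  distinct-scale (suc m) a φ = begin
    distinct m (λ k → a * φ k) + q ^ suc m * distinct m (λ k → a * φ (suc m ∸ k))
      ≈⟨ +-cong (distinct-scale m a φ) (*-congˡ (distinct-scale m a (φ ∘ (suc m ∸_)))) ⟩
    a * distinct m φ + q ^ suc m * (a * distinct m (φ ∘ (suc m ∸_)))
      ≈⟨ solve 4 (λ a d w d′ → a :* d :+ w :* (a :* d′) := a :* (d :+ w :* d′))
           refl a (distinct m φ) (q ^ suc m) (distinct m (φ ∘ (suc m ∸_))) ⟩
    a * distinct (suc m) φ ∎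

  -- The partitions with largest part exactly m + 1 make up the difference `Δ`, so the value and the
  -- difference are matched together.
  distinct-rogersSzegő : ∀ z m → distinct m (z ^_) ≈ rogersSzegő (q * z) m
  distinct-Δ           : ∀ z m → q ^ suc m * distinct m (λ k → z ^ (suc m ∸ k)) ≈ Δ (q * z) m

  distinct-rogersSzegő z zero    = refl
  distinct-rogersSzegő z (suc m) = +-cong (distinct-rogersSzegő z m) (distinct-Δ z m)

  distinct-Δ z zero    =
    solve 2 (λ q z → (q :* con 1) :* (z :* con 1) := q :* z) refl q z
  distinct-Δ z (suc m) = begin
    -- Below the largest part m + 2, the part m + 1 is absent or present. If absent, one z splits
    -- off from the exponent m + 2 - k. If present, the exponent (m + 2) - ((m + 1) - k) is k + 1.
    q ^ suc (suc m) * (distinct m (λ k → z ^ (suc (suc m) ∸ k)) +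
                       q ^ suc m * distinct m (λ k → z ^ (suc (suc m) ∸ (suc m ∸ k))))
      ≈⟨ *-congˡ (+-cong
           (trans (distinct-cong m λ k≤m →
                    reflexive (≡.cong (z ^_) (ℕₚ.+-∸-assoc 1 (ℕₚ.m≤n⇒m≤1+n k≤m))))
                  (distinct-scale m z (λ k → z ^ (suc m ∸ k))))
           (*-congˡ (trans (distinct-cong m λ k≤m → reflexive (≡.cong (z ^_) (reflect k≤m)))
                           (distinct-scale m z (z ^_))))) ⟩
    q ^ suc (suc m) * (z * distinct m (λ k → z ^ (suc m ∸ k)) +
                       q ^ suc m * (z * distinct m (z ^_)))
      ≈⟨ solve 5 (λ q w z d′ d →
           (q :* w) :* (z :* d′ :+ w :* (z :* d)) := q :* z :* (w :* d′ :+ w :* w :* d))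
           refl q (q ^ suc m) z (distinct m (λ k → z ^ (suc m ∸ k))) (distinct m (z ^_)) ⟩
    q * z * (q ^ suc m * distinct m (λ k → z ^ (suc m ∸ k)) +
             q ^ suc m * q ^ suc m * distinct m (z ^_))
      ≈⟨ *-congˡ (+-cong (distinct-Δ z m)
           (*-cong (sym (p^≈q^q^ (suc m))) (distinct-rogersSzegő z m))) ⟩
    Δ (q * z) (suc m) ∎
    where
    reflect : ∀ {k} → k ≤ m → suc (suc m) ∸ (suc m ∸ k) ≡ suc k
    reflect {k} k≤m = ≡.trans
      (ℕₚ.+-∸-assoc 1 (ℕₚ.m∸n≤m (suc m) k))
      (≡.cong suc (ℕₚ.m∸[m∸n]≡n (ℕₚ.m≤n⇒m≤1+n k≤m)))

  euler-congˡ : ∀ {x x′} → x ≈ x′ → ∀ m → euler x m ≈ euler x′ m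
  euler-congˡ x≈ zero    = refl
  euler-congˡ x≈ (suc m) = +-cong (euler-congˡ x≈ m) (*-congʳ (^-congˡ (suc m) x≈))

  rogersSzegő-congˡ : ∀ {x x′} → x ≈ x′ → ∀ m → rogersSzegő x m ≈ rogersSzegő x′ m
  Δ-congˡ           : ∀ {x x′} → x ≈ x′ → ∀ m → Δ x m ≈ Δ x′ m
  rogersSzegő-congˡ x≈ zero    = refl
  rogersSzegő-congˡ x≈ (suc m) = +-cong (rogersSzegő-congˡ x≈ m) (Δ-congˡ x≈ m)
  Δ-congˡ x≈ zero              = x≈
  Δ-congˡ x≈ (suc m)           = *-cong x≈
    (+-cong (Δ-congˡ x≈ m) (*-congˡ (rogersSzegő-congˡ x≈ m)))

  -- The hypothesis counts the part m + 1 as absent, occurring once, or occurring at least twice,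
  -- where the last case returns to X. Collecting terms gives a fixed-point equation with k =
  -- q^(2(m+1)), which the product also satisfies.
  even-distinct-suc : ∀ m φ {X} →
    X ≈ even m * distinct m φ + q ^ suc m * (even m * distinct m (φ ∘ (suc m ∸_)) + q ^ suc m * X) →
    X ≈ even (suc m) * distinct (suc m) φ
  even-distinct-suc m φ {X} X≈ = fixed-unique {f = even m * D} (p^suc≈q* m)
    (begin
      X ≈⟨ X≈ ⟩
      even m * distinct m φ + Q * (even m * D′ + Q * X)
        ≈⟨ solve 5 (λ z d Q d′ x →
             z :* d :+ Q :* (z :* d′ :+ Q :* x) := z :* (d :+ Q :* d′) :+ (Q :* Q) :* x)
             refl (even m) (distinct m φ) Q D′ X ⟩
      even m * D + Q * Q * X
        ≈⟨ +-congˡ (*-congʳ (p^≈q^q^ (suc m))) ⟨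
      even m * D + p ^ suc m * X ∎)
    (begin
      even (suc m) * D
        ≈⟨ *-congʳ (even-suc m) ⟩
      (even m + p ^ suc m * even (suc m)) * D
        ≈⟨ solve 4 (λ z u z′ d → (z :+ u :* z′) :* d := z :* d :+ u :* (z′ :* d))
             refl (even m) (p ^ suc m) (even (suc m)) D ⟩
      even m * D + p ^ suc m * (even (suc m) * D) ∎)
    where
    Q D D′ : Carrier
    Q  = q ^ suc m
    D  = distinct (suc m) φ
    D′ = distinct m (φ ∘ (suc m ∸_))

  -- Here two copies of m + 1 settle the power of y, so the last case is known and not recursive. It
  -- supplies the term of degree m + 1 of Euler's series at q²y.
  euler-distinct-suc : ∀ y m φ →
    euler (p * y) m * distinct m φ +
      q ^ suc m * (euler (p * y) m * distinct m (φ ∘ (suc m ∸_)) +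
                   q ^ suc m * (y ^ suc m * (even (suc m) * distinct (suc m) φ))) ≈
    euler (p * y) (suc m) * distinct (suc m) φ
  euler-distinct-suc y m φ = begin
    e * d + Q * (e * d′ + Q * (Y * (Z * (d + Q * d′))))
      ≈⟨ solve 6 (λ e d Q d′ Y Z →
           e :* d :+ Q :* (e :* d′ :+ Q :* (Y :* (Z :* (d :+ Q :* d′)))) :=
           (e :+ ((Q :* Q) :* Y) :* Z) :* (d :+ Q :* d′))
           refl e d Q d′ Y Z ⟩
    (e + (Q * Q * Y) * Z) * (d + Q * d′)
      ≈⟨ *-congʳ (+-congˡ (*-congʳ
           (trans (*-congʳ (sym (p^≈q^q^ (suc m)))) (sym (^-distrib-* p y (suc m)))))) ⟩
    euler (p * y) (suc m) * distinct (suc m) φ ∎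
    where
    e d d′ Q Y Z : Carrier
    e  = euler (p * y) m
    d  = distinct m φ
    d′ = distinct m (φ ∘ (suc m ∸_))
    Q  = q ^ suc m
    Y  = y ^ suc m
    Z  = even (suc m)

  -- 1 / ((y;q²)_∞ (z;q²)_∞)
  eulerProduct : Carrier → Carrier → Carrier
  eulerProduct y z = euler y N * rogersSzegő z N

  eulerProduct-cong : ∀ {u u′ v v′} → u ≈ u′ → v ≈ v′ → eulerProduct u v ≈ eulerProduct u′ v′
  eulerProduct-cong u≈ v≈ = *-cong (euler-congˡ u≈ N) (rogersSzegő-congˡ v≈ N)

  eulerProduct-0 : ∀ {u v} → u ≈ 0# → v ≈ 0# → eulerProduct u v ≈ 1#
  eulerProduct-0 u≈0 v≈0 = trans (*-cong (euler-0 u≈0 N) (rogersSzegő-0 v≈0 N)) (*-identityˡ 1#)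

  -- E₊ is (1 + x)/(1 - x) E, and the factors T and T⁻ change by 1 - x and 1 + x.
  overpartition-step : ∀ {E E′ E₊ x x⁻ K K⁻ T T₊ T⁻ T₊⁻} →
    E′ ≈ E + x * E′ → E₊ ≈ E′ + x * E′ →
    T ≈ T₊ + x * T → T⁻ ≈ T₊⁻ + x⁻ * T⁻ → x⁻ + x ≈ 0# →
    E * (K⁻ * T) ≈ K * T⁻ → E₊ * (K⁻ * T₊) ≈ K * T₊⁻
  overpartition-step {E} {E′} {E₊} {x} {x⁻} {K} {K⁻} {T} {T₊} {T⁻} {T₊⁻}
    E′≈ E₊≈ T≈ T⁻≈ x⁻+x≈0 ET≈ = begin
    E₊ * (K⁻ * T₊)
      ≈⟨ *-congʳ E₊≈ ⟩
    (E′ + x * E′) * (K⁻ * T₊)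
      ≈⟨ solve 4 (λ E′ x K⁻ T₊ →
           (E′ :+ x :* E′) :* (K⁻ :* T₊) := K⁻ :* (E′ :* T₊) :+ x :* (K⁻ :* (E′ :* T₊)))
           refl E′ x K⁻ T₊ ⟩
    K⁻ * (E′ * T₊) + x * (K⁻ * (E′ * T₊))
      ≈⟨ +-cong (*-congˡ E′T₊≈) (*-congˡ (*-congˡ E′T₊≈)) ⟩
    K⁻ * (E * T) + x * (K⁻ * (E * T))
      ≈⟨ solve 4 (λ E T K⁻ x →
           K⁻ :* (E :* T) :+ x :* (K⁻ :* (E :* T)) := (con 1 :+ x) :* (E :* (K⁻ :* T)))
           refl E T K⁻ x ⟩
    (1# + x) * (E * (K⁻ * T))
      ≈⟨ *-congˡ ET≈ ⟩
    (1# + x) * (K * T⁻)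
      ≈⟨ solve 3 (λ x K T⁻ → (con 1 :+ x) :* (K :* T⁻) := K :* (T⁻ :+ x :* T⁻)) refl x K T⁻ ⟩
    K * (T⁻ + x * T⁻)
      ≈⟨ *-congˡ T⁻+xT⁻≈ ⟩
    K * T₊⁻ ∎
    where
    E′T₊≈ : E′ * T₊ ≈ E * T
    E′T₊≈ = ∙-cancelʳ (x * (E′ * T)) (E′ * T₊) (E * T) (begin
      E′ * T₊ + x * (E′ * T)
        ≈⟨ solve 4 (λ E′ T₊ x T → E′ :* T₊ :+ x :* (E′ :* T) := E′ :* (T₊ :+ x :* T))
             refl E′ T₊ x T ⟩
      E′ * (T₊ + x * T)       ≈⟨ *-congˡ T≈ ⟨
      E′ * T                  ≈⟨ *-congʳ E′≈ ⟩
      (E + x * E′) * T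
        ≈⟨ solve 4 (λ E x E′ T → (E :+ x :* E′) :* T := E :* T :+ x :* (E′ :* T))
             refl E x E′ T ⟩
      E * T + x * (E′ * T)    ∎)

    T⁻+xT⁻≈ : T⁻ + x * T⁻ ≈ T₊⁻
    T⁻+xT⁻≈ = begin
      T⁻ + x * T⁻                   ≈⟨ +-congʳ T⁻≈ ⟩
      (T₊⁻ + x⁻ * T⁻) + x * T⁻
        ≈⟨ solve 4 (λ t x⁻ T x → (t :+ x⁻ :* T) :+ x :* T := t :+ (x⁻ :+ x) :* T)
             refl T₊⁻ x⁻ T⁻ x ⟩
      T₊⁻ + (x⁻ + x) * T⁻           ≈⟨ +-congˡ (*-congʳ x⁻+x≈0) ⟩
      T₊⁻ + 0# * T⁻                 ≈⟨ +-congˡ (zeroˡ T⁻) ⟩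
      T₊⁻ + 0#                      ≈⟨ +-identityʳ T₊⁻ ⟩
      T₊⁻                           ∎

  -- The telescoping product for overpartitions

  module _
    -- `E m` stands for the overpartitions with parts at most m, `E′ m` for those in which m is not
    -- overlined, and `w m` for the weight of a part m.
    (y z : Carrier) (E E′ w : ℕ → Carrier) (E-0 : E 0 ≈ 1#)
    (E-suc  : ∀ m → E (suc m) ≈ E′ (suc m) + q ^ suc m * (w (suc m) * E′ (suc m)))
    (E′-suc : ∀ m → E′ (suc m) ≈ E m + q ^ suc m * (w (suc m) * E′ (suc m)))
    (w-odd  : ∀ j → w (1 ℕ.+ 2 ℕ.* j) ≈ z) (w-even : ∀ j → w (2 ℕ.+ 2 ℕ.* j) ≈ y)
    where

    -- The contributions to J(y,z;q) of the parts greater than 2j and, in mid, than 2j + 1.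
    tail mid : Carrier → Carrier → ℕ → Carrier
    tail y z j = eulerProduct (p ^ suc j * y) (p ^ j * (q * z))
    mid  y z j = eulerProduct (p ^ suc j * y) (p ^ suc j * (q * z))

    K K⁻ : Carrier
    K  = tail y z 0
    K⁻ = tail (- y) (- z) 0

    even≈q* : ∀ y j → p ^ suc j * y ≈ q * (q * p ^ j * y)
    even≈q* y j = solve 3 (λ q w y → ((q :* q) :* w) :* y := q :* (q :* w :* y)) refl q (p ^ j) y

    odd≈q* : ∀ z j → p ^ j * (q * z) ≈ q * (p ^ j * z)
    odd≈q* z j = solve 3 (λ q w z → w :* (q :* z) := q :* (w :* z)) refl q (p ^ j) z

    -- The equation G(x) = G(q²x) + x G(x) of the Rogers-Szegő factor at x = zq^(2j+1) takes the odd
    -- size 2j + 1 out of the tail. For even sizes Euler's factor at yq^(2j+2) does the same in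
    -- `mid-even`.
    tail-odd : ∀ y z j → tail y z j ≈ mid y z j + p ^ j * (q * z) * tail y z j
    tail-odd y z j = begin
      e * rogersSzegő x N
        ≈⟨ *-congˡ (rogersSzegő-fixed (odd≈q* z j)) ⟩
      e * (rogersSzegő (p * x) N + x * rogersSzegő x N)
        ≈⟨ solve 4 (λ e r′ x r → e :* (r′ :+ x :* r) := e :* r′ :+ x :* (e :* r))
             refl e (rogersSzegő (p * x) N) x (rogersSzegő x N) ⟩
      e * rogersSzegő (p * x) N + x * (e * rogersSzegő x N)
        ≈⟨ +-congʳ (*-congˡ (rogersSzegő-congˡ (sym (*-assoc p (p ^ j) (q * z))) N)) ⟩
      mid y z j + x * tail y z j ∎
      where
      e x : Carrier
      e = euler (p ^ suc j * y) N
      x = p ^ j * (q * z)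

    mid-even : ∀ y z j → mid y z j ≈ tail y z (suc j) + p ^ suc j * y * mid y z j
    mid-even y z j = begin
      euler x N * r
        ≈⟨ *-congʳ (euler-fixed (even≈q* y j)) ⟩
      (euler (p * x) N + x * euler x N) * r
        ≈⟨ solve 4 (λ e′ x e r → (e′ :+ x :* e) :* r := e′ :* r :+ x :* (e :* r))
             refl (euler (p * x) N) x (euler x N) r ⟩
      euler (p * x) N * r + x * (euler x N * r)
        ≈⟨ +-congʳ (*-congʳ (euler-congˡ (sym (*-assoc p (p ^ suc j) y)) N)) ⟩
      tail y z (suc j) + x * mid y z j ∎
      where
      r x : Carrier
      r = rogersSzegő (p ^ suc j * (q * z)) N
      x = p ^ suc j * y

    cancel : ∀ a b → a * (- b) + a * b ≈ 0#
    cancel a b = trans (sym (distribˡ a (- b) b)) (trans (*-congˡ (-‿inverseˡ b)) (zeroʳ a))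

    q^2j≈p^j : ∀ j → q ^ (2 ℕ.* j) ≈ p ^ j
    q^2j≈p^j j = trans (sym (^-assocʳ q 2 j)) (^-congˡ j (*-congˡ (*-identityʳ q)))

    odd-weight : ∀ j e → q ^ (1 ℕ.+ 2 ℕ.* j) * (w (1 ℕ.+ 2 ℕ.* j) * e) ≈ p ^ j * (q * z) * e
    odd-weight j e = begin
      (q * q ^ (2 ℕ.* j)) * (w (1 ℕ.+ 2 ℕ.* j) * e)
        ≈⟨ *-cong (*-congˡ (q^2j≈p^j j)) (*-congʳ (w-odd j)) ⟩
      (q * p ^ j) * (z * e)
        ≈⟨ solve 4 (λ q u z e → (q :* u) :* (z :* e) := u :* (q :* z) :* e) refl q (p ^ j) z e ⟩
      p ^ j * (q * z) * e ∎

    even-weight : ∀ j e → q ^ (2 ℕ.+ 2 ℕ.* j) * (w (2 ℕ.+ 2 ℕ.* j) * e) ≈ p ^ suc j * y * e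
    even-weight j e = begin
      (q * (q * q ^ (2 ℕ.* j))) * (w (2 ℕ.+ 2 ℕ.* j) * e)
        ≈⟨ *-cong (*-congˡ (*-congˡ (q^2j≈p^j j))) (*-congʳ (w-even j)) ⟩
      (q * (q * p ^ j)) * (y * e)
        ≈⟨ solve 4 (λ q u y e → (q :* (q :* u)) :* (y :* e) := (q :* q :* u) :* y :* e)
             refl q (p ^ j) y e ⟩
      p ^ suc j * y * e ∎

    even-tail : ∀ j → E (2 ℕ.* j) * (K⁻ * tail y z j) ≈ K * tail (- y) (- z) j
    odd-mid   : ∀ j → E (1 ℕ.+ 2 ℕ.* j) * (K⁻ * mid y z j) ≈ K * mid (- y) (- z) j

    even-tail zero    = begin
      E 0 * (K⁻ * K)  ≈⟨ *-congʳ E-0 ⟩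
      1# * (K⁻ * K)   ≈⟨ *-identityˡ _ ⟩
      K⁻ * K          ≈⟨ *-comm K⁻ K ⟩
      K * K⁻          ∎
    even-tail (suc j) = trans
      (reflexive (≡.cong (λ m → E m * (K⁻ * tail y z (suc j))) (ℕₚ.*-suc 2 j)))
      (overpartition-step
        (trans (E′-suc m) (+-congˡ (even-weight j _)))
        (trans (E-suc m) (+-congˡ (even-weight j _)))
        (mid-even y z j) (mid-even (- y) (- z) j) (cancel (p ^ suc j) y) (odd-mid j))
      where
      m : ℕ
      m = 1 ℕ.+ 2 ℕ.* j

    odd-mid j = overpartition-step
      (trans (E′-suc m) (+-congˡ (odd-weight j _)))
      (trans (E-suc m) (+-congˡ (odd-weight j _)))
      (tail-odd y z j) (tail-odd (- y) (- z) j)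
      (trans (+-cong (sym (*-assoc _ _ _)) (sym (*-assoc _ _ _))) (cancel (p ^ j * q) z))
      (even-tail j)
      where
      m : ℕ
      m = 2 ℕ.* j

    -- Both arguments contain q^(N+1), as q^(2N+2) and q^(2N+1) do, so the limit is reached exactly
    -- at j = N.
    tail-N : ∀ y z → tail y z N ≈ 1#
    tail-N y z = eulerProduct-0
      (trans (*-congʳ p^1+N≈0) (zeroˡ y))
      (begin
        p ^ N * (q * z)           ≈⟨ *-congʳ (p^≈q^q^ N) ⟩
        (q ^ N * q ^ N) * (q * z)
          ≈⟨ solve 3 (λ w q z → (w :* w) :* (q :* z) := (q :* w) :* (w :* z)) refl (q ^ N) q z ⟩
        q ^ suc N * (q ^ N * z)   ≈⟨ q^[1+N]*≈0 _ ⟩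
        0#                        ∎)
      where
      p^1+N≈0 : p ^ suc N ≈ 0#
      p^1+N≈0 = multiple-nilpotent refl

    overpartition-quotient :
      E (2 ℕ.* N) * eulerProduct (p * (- y)) (q * (- z)) ≈ eulerProduct (p * y) (q * z)
    overpartition-quotient = begin
      E (2 ℕ.* N) * eulerProduct (p * (- y)) (q * (- z))  ≈⟨ *-congˡ (tail-0 (- y) (- z)) ⟨
      E (2 ℕ.* N) * K⁻                                    ≈⟨ *-congˡ (*-identityʳ K⁻) ⟨
      E (2 ℕ.* N) * (K⁻ * 1#)                             ≈⟨ *-congˡ (*-congˡ (tail-N y z)) ⟨
      E (2 ℕ.* N) * (K⁻ * tail y z N)                     ≈⟨ even-tail N ⟩
      K * tail (- y) (- z) N                              ≈⟨ *-congˡ (tail-N (- y) (- z)) ⟩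
      K * 1#                                              ≈⟨ *-identityʳ K ⟩
      K                                                   ≈⟨ tail-0 y z ⟩
      eulerProduct (p * y) (q * z)                        ∎
      where
      tail-0 : ∀ y z → tail y z 0 ≈ eulerProduct (p * y) (q * z)
      tail-0 y z = eulerProduct-cong (*-congʳ (*-identityʳ p)) (*-identityˡ (q * z))

-- Power series truncated after degree N

module SeriesProperties {c ℓ} (R : CommutativeRing c ℓ) where
  open CommutativeRing R hiding (zero)
  open PowerSeries R
  open RingSolver commutativeSemiring using (solve; _:=_; _:+_; _:*_; con)
  open SetoidReasoning setoid

  infixl 6 _⊕_
  _⊕_ : Series → Series → Series
  (f ⊕ g) n = f n + g n

  infixr 7 _⊙_
  _⊙_ : Carrier → Series → Series
  (a ⊙ f) n = a * f n

  const : Carrier → Series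
  const a zero    = a
  const a (suc n) = 0#

  -- Coefficient n of a product involves only coefficients up to n, so the product is well defined
  -- modulo every q^(N+1).
  ⊛-cong-≤ : ∀ f f′ g g′ n → (∀ {k} → k ≤ n → f k ≈ f′ k) → (∀ {k} → k ≤ n → g k ≈ g′ k) →
             (f ⊛ g) n ≈ (f′ ⊛ g′) n
  ⊛-cong-≤ f f′ g g′ zero    f≈ g≈ = +-congʳ (*-cong (f≈ z≤n) (g≈ z≤n))
  ⊛-cong-≤ f f′ g g′ (suc n) f≈ g≈ = +-cong
    (*-cong (f≈ z≤n) (g≈ ℕₚ.≤-refl))
    (⊛-cong-≤ (f ∘ suc) (f′ ∘ suc) g g′ n (f≈ ∘ s≤s) (g≈ ∘ ℕₚ.m≤n⇒m≤1+n))

  ⊛-distribʳ : ∀ h f g → (f ⊕ g) ⊛ h ≋ f ⊛ h ⊕ g ⊛ h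
  ⊛-distribʳ h f g zero    =
    solve 3 (λ a b c → (a :+ b) :* c :+ con 0 := (a :* c :+ con 0) :+ (b :* c :+ con 0))
      refl (f 0) (g 0) (h 0)
  ⊛-distribʳ h f g (suc n) = begin
    (f 0 + g 0) * h (suc n) + ((f ∘ suc ⊕ g ∘ suc) ⊛ h) n
      ≈⟨ +-congˡ (⊛-distribʳ h (f ∘ suc) (g ∘ suc) n) ⟩
    (f 0 + g 0) * h (suc n) + ((f ∘ suc ⊛ h) n + (g ∘ suc ⊛ h) n)
      ≈⟨ solve 5 (λ a b c u v → (a :+ b) :* c :+ (u :+ v) := (a :* c :+ u) :+ (b :* c :+ v))
           refl (f 0) (g 0) (h (suc n)) ((f ∘ suc ⊛ h) n) ((g ∘ suc ⊛ h) n) ⟩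
    (f ⊛ h) (suc n) + (g ⊛ h) (suc n) ∎

  ⊙-⊛ : ∀ a f g → (a ⊙ f) ⊛ g ≋ a ⊙ (f ⊛ g)
  ⊙-⊛ a f g zero    =
    solve 3 (λ a b c → (a :* b) :* c :+ con 0 := a :* (b :* c :+ con 0)) refl a (f 0) (g 0)
  ⊙-⊛ a f g (suc n) = trans
    (+-congˡ (⊙-⊛ a (f ∘ suc) g n))
    (solve 4 (λ a b c u → (a :* b) :* c :+ a :* u := a :* (b :* c :+ u))
      refl a (f 0) (g (suc n)) ((f ∘ suc ⊛ g) n))

  ⊛-assoc : ∀ f g h → (f ⊛ g) ⊛ h ≋ f ⊛ (g ⊛ h)
  ⊛-assoc f g h zero    =
    solve 3 (λ a b c → (a :* b :+ con 0) :* c :+ con 0 := a :* (b :* c :+ con 0) :+ con 0)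
      refl (f 0) (g 0) (h 0)
  ⊛-assoc f g h (suc n) = begin
    (f 0 * g 0 + 0#) * h (suc n) + ((f ⊛ g) ∘ suc ⊛ h) n
      ≈⟨ +-congˡ (begin
           -- By definition of the product, this left factor is `(f ⊛ g) ∘ suc`.
           ((f 0 ⊙ (g ∘ suc) ⊕ f ∘ suc ⊛ g) ⊛ h) n
             ≈⟨ ⊛-distribʳ h (f 0 ⊙ (g ∘ suc)) (f ∘ suc ⊛ g) n ⟩
           ((f 0 ⊙ (g ∘ suc)) ⊛ h) n + ((f ∘ suc ⊛ g) ⊛ h) n
             ≈⟨ +-cong (⊙-⊛ (f 0) (g ∘ suc) h n) (⊛-assoc (f ∘ suc) g h n) ⟩
           f 0 * (g ∘ suc ⊛ h) n + (f ∘ suc ⊛ (g ⊛ h)) n ∎) ⟩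
    (f 0 * g 0 + 0#) * h (suc n) + (f 0 * (g ∘ suc ⊛ h) n + (f ∘ suc ⊛ (g ⊛ h)) n)
      ≈⟨ solve 5 (λ a b c u v →
           (a :* b :+ con 0) :* c :+ (a :* u :+ v) := a :* (b :* c :+ u) :+ v)
           refl (f 0) (g 0) (h (suc n)) ((g ∘ suc ⊛ h) n) ((f ∘ suc ⊛ (g ⊛ h)) n) ⟩
    (f ⊛ (g ⊛ h)) (suc n) ∎

  -- The product unfolds along its left factor. Unfolding it along the right one is what the
  -- induction for commutativity requires.
  ⊛-suc : ∀ f g n → (f ⊛ g) (suc n) ≈ f (suc n) * g 0 + (f ⊛ g ∘ suc) n
  ⊛-suc f g zero    =
    solve 4 (λ a b c d → a :* b :+ (c :* d :+ con 0) := c :* d :+ (a :* b :+ con 0))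
      refl (f 0) (g 1) (f 1) (g 0)
  ⊛-suc f g (suc n) = begin
    f 0 * g (suc (suc n)) + (f ∘ suc ⊛ g) (suc n)
      ≈⟨ +-congˡ (⊛-suc (f ∘ suc) g n) ⟩
    f 0 * g (suc (suc n)) + (f (suc (suc n)) * g 0 + (f ∘ suc ⊛ g ∘ suc) n)
      ≈⟨ solve 3 (λ a b c → a :+ (b :+ c) := b :+ (a :+ c)) refl
           (f 0 * g (suc (suc n))) (f (suc (suc n)) * g 0) ((f ∘ suc ⊛ g ∘ suc) n) ⟩
    f (suc (suc n)) * g 0 + (f ⊛ g ∘ suc) (suc n) ∎

  ⊛-comm : ∀ f g → f ⊛ g ≋ g ⊛ f
  ⊛-comm f g zero    = +-congʳ (*-comm (f 0) (g 0))
  ⊛-comm f g (suc n) = begin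
    f 0 * g (suc n) + (f ∘ suc ⊛ g) n
      ≈⟨ +-cong (*-comm (f 0) (g (suc n))) (⊛-comm (f ∘ suc) g n) ⟩
    g (suc n) * f 0 + (g ⊛ f ∘ suc) n
      ≈⟨ ⊛-suc g f n ⟨
    (g ⊛ f) (suc n) ∎

  0-⊛ : ∀ {f} g → (∀ n → f n ≈ 0#) → ∀ n → (f ⊛ g) n ≈ 0#
  0-⊛ g f≈0 zero    = trans (+-identityʳ _) (trans (*-congʳ (f≈0 0)) (zeroˡ _))
  0-⊛ g f≈0 (suc n) = trans
    (+-cong (trans (*-congʳ (f≈0 0)) (zeroˡ _)) (0-⊛ g (f≈0 ∘ suc) n)) (+-identityʳ 0#)

  const-⊛ : ∀ a f → const a ⊛ f ≋ a ⊙ f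
  const-⊛ a f zero    = +-identityʳ _
  const-⊛ a f (suc n) = trans (+-congˡ (0-⊛ f (λ _ → refl) n)) (+-identityʳ _)

  ⊛-identityˡ : ∀ f → const 1# ⊛ f ≋ f
  ⊛-identityˡ f n = trans (const-⊛ 1# f n) (*-identityˡ (f n))

  q : Series
  q zero    = 0#
  q (suc n) = const 1# n

  -- qᵐ f, as a function of the sequence of coefficients
  shift : ℕ → Series → Series
  shift zero    f n       = f n
  shift (suc m) f zero    = 0#
  shift (suc m) f (suc n) = shift m f n

  q-⊛ : ∀ f → q ⊛ f ≋ shift 1 f
  q-⊛ f zero    = trans (+-identityʳ _) (zeroˡ _)
  q-⊛ f (suc n) = trans (+-cong (zeroˡ _) (⊛-identityˡ f n)) (+-identityˡ (f n))

  shift-cong : ∀ m {f g} → f ≋ g → shift m f ≋ shift m g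
  shift-cong zero    f≋g n       = f≋g n
  shift-cong (suc m) f≋g zero    = refl
  shift-cong (suc m) f≋g (suc n) = shift-cong m f≋g n

  shift-suc : ∀ m f → shift 1 (shift m f) ≋ shift (suc m) f
  shift-suc m f zero    = refl
  shift-suc m f (suc n) = refl

  shift-≡0 : ∀ m f {n} → n ℕ.< m → shift m f n ≈ 0#
  shift-≡0 (suc m) f {zero}  _         = refl
  shift-≡0 (suc m) f {suc n} (s≤s n<m) = shift-≡0 m f n<m

  const-* : ∀ a b → const (a * b) ≋ const a ⊛ const b
  const-* a b zero    = sym (const-⊛ a (const b) zero)
  const-* a b (suc n) = sym (trans (const-⊛ a (const b) (suc n)) (zeroʳ a))

  module _ (N : ℕ) where

    -- The quotient by q^(N+1) is formed by weakening equality to agreement up to degree N, so its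
    -- elements are still series and `q` is nilpotent.
    truncated : CommutativeRing c ℓ
    truncated = record
      { Carrier = Series
      ; _≈_     = λ f g → ∀ {n} → n ≤ N → f n ≈ g n
      ; _+_     = _⊕_
      ; _*_     = _⊛_
      ; -_      = λ f n → - f n
      ; 0#      = λ _ → 0#
      ; 1#      = const 1#
      ; isCommutativeRing = record
        { isRing = record
          { +-isAbelianGroup = record
            { isGroup = record
              { isMonoid = record
                { isSemigroup = record
                  { isMagma = record
                    { isEquivalence = record
                      { refl  = λ _ → refl
                      ; sym   = λ f≈g n≤ → sym (f≈g n≤)
                      ; trans = λ f≈g g≈h n≤ → trans (f≈g n≤) (g≈h n≤)
                      }
                    ; ∙-cong = λ f≈ g≈ n≤ → +-cong (f≈ n≤) (g≈ n≤)
                    }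
                  ; assoc = λ f g h {n} _ → +-assoc (f n) (g n) (h n)
                  }
                ; identity = (λ f {n} _ → +-identityˡ (f n)) , λ f {n} _ → +-identityʳ (f n)
                }
              ; inverse = (λ f {n} _ → -‿inverseˡ (f n)) , λ f {n} _ → -‿inverseʳ (f n)
              ; ⁻¹-cong = λ f≈g n≤ → -‿cong (f≈g n≤)
              }
            ; comm = λ f g {n} _ → +-comm (f n) (g n)
            }
          ; *-cong     = λ {f} {f′} {g} {g′} f≈ g≈ {n} n≤ →
              ⊛-cong-≤ f f′ g g′ n (λ k≤ → f≈ (ℕₚ.≤-trans k≤ n≤)) (λ k≤ → g≈ (ℕₚ.≤-trans k≤ n≤))
          ; *-assoc    = λ f g h {n} _ → ⊛-assoc f g h n
          ; *-identity = (λ f {n} _ → ⊛-identityˡ f n)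
                       , λ f {n} _ → trans (⊛-comm f (const 1#) n) (⊛-identityˡ f n)
          ; distrib    =
              (λ f g h {n} _ → trans (⊛-comm f (g ⊕ h) n)
                (trans (⊛-distribʳ f g h n) (+-cong (⊛-comm g f n) (⊛-comm h f n))))
              , λ f g h {n} _ → ⊛-distribʳ f g h n
          }
        ; *-comm = λ f g {n} _ → ⊛-comm f g n
        }
      }

    open ExpProperties (CommutativeRing.commutativeSemiring truncated) using (_^_)
    open ExpProperties commutativeSemiring using () renaming (_^_ to _^ᴿ_)

    -- Links the ring element qᵐ, used in the algebra, to `shift`, which is what removing a part of
    -- size m produces.
    q^-⊛ : ∀ m f → q ^ m ⊛ f ≋ shift m f
    q^-⊛ zero    f n = ⊛-identityˡ f n
    q^-⊛ (suc m) f n = begin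
      ((q ⊛ q ^ m) ⊛ f) n      ≈⟨ ⊛-assoc q (q ^ m) f n ⟩
      (q ⊛ (q ^ m ⊛ f)) n      ≈⟨ q-⊛ (q ^ m ⊛ f) n ⟩
      shift 1 (q ^ m ⊛ f) n    ≈⟨ shift-cong 1 (q^-⊛ m f) n ⟩
      shift 1 (shift m f) n    ≈⟨ shift-suc m f n ⟩
      shift (suc m) f n        ∎

    q^1+N≈0 : ∀ {n} → n ≤ N → (q ^ suc N) n ≈ 0#
    q^1+N≈0 {n} n≤N = begin
      (q ^ suc N) n                 ≈⟨ ⊛-identityˡ (q ^ suc N) n ⟨
      (const 1# ⊛ q ^ suc N) n      ≈⟨ ⊛-comm (const 1#) (q ^ suc N) n ⟩
      (q ^ suc N ⊛ const 1#) n      ≈⟨ q^-⊛ (suc N) (const 1#) n ⟩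
      shift (suc N) (const 1#) n    ≈⟨ shift-≡0 (suc N) (const 1#) (s≤s n≤N) ⟩
      0#                            ∎

    const-^ : ∀ a m → const (a ^ᴿ m) ≋ const a ^ m
    const-^ a zero    n = refl
    const-^ a (suc m) n = trans (const-* a (a ^ᴿ m) n)
      (⊛-cong-≤ (const a) (const a) (const (a ^ᴿ m)) (const a ^ m) n
        (λ _ → refl) (λ {k} _ → const-^ a m k))

-- Enumerations and sums over them

open Defs
  using (IsPartition; partitions; partitions-unique; ∈-partitions;
         multiplicity; r; s; unpaired; alternatingSum;
         Part; _⊵_; _⊵?_; sizes; e; o;
         IsOverpartition; overpartitions; overpartitions-unique; ∈-overpartitions)

-- Sums over duplicate-free lists with the same members agree, so a counting argument can work with
-- the predicate alone and ignore how the words were generated.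
record Enumeration {A : Set} (P : ℕ → List A → Set) : Set where
  field
    list     : ℕ → List (List A)
    unique   : ∀ n → Unique (list n)
    sound    : ∀ {n x} → x ∈ list n → P n x
    complete : ∀ {n x} → P n x → x ∈ list n

open Enumeration

restrict : ∀ {A} {P : ℕ → List A → Set} {C : List A → Set} →
           Unary.Decidable C → Enumeration P → Enumeration (λ n x → P n x × C x)
restrict C? L .list n           = filter C? (L .list n)
restrict C? L .unique n         = Unique.filter⁺ C? (L .unique n)
restrict C? L .sound x∈         = let x∈L , c = ∈-filter⁻ C? x∈ in L .sound x∈L , c
restrict C? L .complete (p , c) = ∈-filter⁺ C? (L .complete p) c

same-members⇒↭ : ∀ {A : Set} {xs ys : List A} → Unique xs → Unique ys →
                 (∀ {x} → x ∈ xs → x ∈ ys) → (∀ {x} → x ∈ ys → x ∈ xs) → xs ↭ ys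
same-members⇒↭ xs! ys! xs⊆ys ys⊆xs = ∼bag⇒↭ (unique∧set⇒bag xs! ys! (mk⇔ xs⊆ys ys⊆xs))

-- The words a ∷ x, where a has size k and x is listed by F at the remaining size.
prefixed : ∀ {A : Set} → A → ℕ → (ℕ → List (List A)) → ℕ → List (List A)
prefixed a zero    F n       = map (a ∷_) (F n)
prefixed a (suc k) F zero    = []
prefixed a (suc k) F (suc n) = prefixed a k F n

module _ {A : Set} {a : A} where

  ∈-prefixed⁺ : ∀ k F {j x} → x ∈ F j → a ∷ x ∈ prefixed a k F (k ℕ.+ j)
  ∈-prefixed⁺ zero    F x∈ = ∈-map⁺ (a ∷_) x∈
  ∈-prefixed⁺ (suc k) F x∈ = ∈-prefixed⁺ k F x∈

  ∈-prefixed⁻ : ∀ k F n {x} → x ∈ prefixed a k F n →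
                ∃[ x′ ] ∃[ j ] (x ≡ a ∷ x′ × n ≡ k ℕ.+ j × x′ ∈ F j)
  ∈-prefixed⁻ zero    F n       x∈ with x′ , x′∈ , ≡.refl ← ∈-map⁻ (a ∷_) x∈ =
    x′ , n , ≡.refl , ≡.refl , x′∈
  ∈-prefixed⁻ (suc k) F (suc n) x∈ with x′ , j , x≡ , ≡.refl , x′∈ ← ∈-prefixed⁻ k F n x∈ =
    x′ , j , x≡ , ≡.refl , x′∈

  prefixed-unique : ∀ k F n → (∀ j → Unique (F j)) → Unique (prefixed a k F n)
  prefixed-unique zero    F n       F! = Unique.map⁺ ∷-injectiveʳ (F! n)
  prefixed-unique (suc k) F zero    F! = []
  prefixed-unique (suc k) F (suc n) F! = prefixed-unique k F n F!

emptyOnly : ∀ {A} → Enumeration {A} (λ n x → n ≡ 0 × x ≡ [])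
emptyOnly .list zero                         = [ [] ]
emptyOnly .list (suc n)                      = []
emptyOnly .unique zero                       = [] ∷ []
emptyOnly .unique (suc n)                    = []
emptyOnly .sound {zero} (here ≡.refl)        = ≡.refl , ≡.refl
emptyOnly .complete {zero} (≡.refl , ≡.refl) = here ≡.refl

module SumProperties {c ℓ} (R : CommutativeRing c ℓ) where
  open CommutativeRing R hiding (zero)
  open GeneratingFunctions R using (sumOver)
  open SeriesProperties R using (const; shift)

  module _ {A : Set} where

    sumOver-cong : ∀ xs {f g : A → Carrier} → (∀ {x} → x ∈ xs → f x ≈ g x) →
                   sumOver xs f ≈ sumOver xs g
    sumOver-cong []       f≈g = refl
    sumOver-cong (x ∷ xs) f≈g = +-cong (f≈g (here ≡.refl)) (sumOver-cong xs (f≈g ∘ there))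

    sumOver-++ : ∀ xs ys (f : A → Carrier) → sumOver (xs ++ ys) f ≈ sumOver xs f + sumOver ys f
    sumOver-++ []       ys f = sym (+-identityˡ _)
    sumOver-++ (x ∷ xs) ys f = trans (+-congˡ (sumOver-++ xs ys f)) (sym (+-assoc _ _ _))

    sumOver-* : ∀ xs a (f : A → Carrier) → sumOver xs (λ x → a * f x) ≈ a * sumOver xs f
    sumOver-* []       a f = sym (zeroʳ a)
    sumOver-* (x ∷ xs) a f = trans (+-congˡ (sumOver-* xs a f)) (sym (distribˡ a _ _))

    sumOver-↭ : ∀ {xs ys} (f : A → Carrier) → xs ↭ ys → sumOver xs f ≈ sumOver ys f
    sumOver-↭ f ↭.refl           = refl
    sumOver-↭ f (↭.prep x ↭)     = +-congˡ (sumOver-↭ f ↭)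
    sumOver-↭ f (↭.swap x x′ ↭)  = trans (+-congˡ (+-congˡ (sumOver-↭ f ↭)))
      (trans (sym (+-assoc _ _ _)) (trans (+-congʳ (+-comm _ _)) (+-assoc _ _ _)))
    sumOver-↭ f (↭.trans ↭₁ ↭₂)  = trans (sumOver-↭ f ↭₁) (sumOver-↭ f ↭₂)

    sumOver-map : ∀ {B : Set} (g : B → A) xs (f : A → Carrier) →
                  sumOver (map g xs) f ≡ sumOver xs (f ∘ g)
    sumOver-map g []       f = ≡.refl
    sumOver-map g (x ∷ xs) f = ≡.cong (f (g x) +_) (sumOver-map g xs f)

  module _ {A : Set} where

    sumOver-prefixed : ∀ a k F (f : List A → Carrier) n →
      sumOver (prefixed a k F n) f ≡ shift k (λ j → sumOver (F j) (f ∘ (a ∷_))) n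
    sumOver-prefixed a zero    F f n       = sumOver-map (a ∷_) (F n) f
    sumOver-prefixed a (suc k) F f zero    = ≡.refl
    sumOver-prefixed a (suc k) F f (suc n) = sumOver-prefixed a k F f n

    sumOver-unique : ∀ {P Q} (L : Enumeration P) (M : Enumeration {A} Q) n →
      (∀ {x} → P n x → Q n x) → (∀ {x} → Q n x → P n x) →
      ∀ f → sumOver (L .list n) f ≈ sumOver (M .list n) f
    sumOver-unique L M n P⇒Q Q⇒P f = sumOver-↭ f
      (same-members⇒↭ (L .unique n) (M .unique n)
        (M .complete ∘ P⇒Q ∘ L .sound) (L .complete ∘ Q⇒P ∘ M .sound))

    sumOver-empty : ∀ {P} (L : Enumeration {A} P) → P 0 [] →
      (∀ {n x} → P n x → n ≡ 0 × x ≡ []) → ∀ f n → sumOver (L .list n) f ≈ const (f []) n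
    sumOver-empty {P} L P-0 P⇒[] f n = trans
      (sumOver-unique L emptyOnly n P⇒[] (λ { (≡.refl , ≡.refl) → P-0 }) f) (only n)
      where
      only : ∀ n → sumOver (emptyOnly .list n) f ≈ const (f []) n
      only zero    = +-identityʳ (f [])
      only (suc n) = refl

    -- Turns a case distinction on the first letter into a recurrence of series: a word in `P` lies
    -- in `Q`, or is `a` followed by a word in `H`. The last hypothesis keeps the two cases
    -- disjoint.
    sumOver-head : ∀ {P Q H} (L : Enumeration P) (M : Enumeration Q) (K : Enumeration H) a k →
      (∀ {n x} → P n x → Q n x ⊎ ∃[ x′ ] ∃[ j ] (x ≡ a ∷ x′ × n ≡ k ℕ.+ j × H j x′)) →
      (∀ {n x} → Q n x → P n x) → (∀ {j x} → H j x → P (k ℕ.+ j) (a ∷ x)) →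
      (∀ {n x} → ¬ Q n (a ∷ x)) →
      ∀ f n → sumOver (L .list n) f ≈
              sumOver (M .list n) f + shift k (λ j → sumOver (K .list j) (f ∘ (a ∷_))) n
    sumOver-head {P} {Q} L M K a k split Q⇒P H⇒P ¬Q f n = trans
      (sumOver-↭ f (same-members⇒↭ (L .unique n)
        (Unique.++⁺ (M .unique n) (prefixed-unique k (K .list) n (K .unique)) disjoint)
        (to ∘ split ∘ L .sound) (from ∘ ∈-++⁻ (M .list n))))
      (trans (sumOver-++ (M .list n) _ f)
        (+-congˡ (reflexive (sumOver-prefixed a k (K .list) f n))))
      where
      rest : List (List A)
      rest = prefixed a k (K .list) n

      disjoint : ∀ {x} → ¬ (x ∈ M .list n × x ∈ rest)
      disjoint (x∈M , x∈rest) with _ , _ , ≡.refl , _ ← ∈-prefixed⁻ k (K .list) n x∈rest =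
        ¬Q (M .sound x∈M)

      to : ∀ {x} → Q n x ⊎ ∃[ x′ ] ∃[ j ] (x ≡ a ∷ x′ × n ≡ k ℕ.+ j × _) → x ∈ M .list n ++ rest
      to (inj₁ qx)                             = ∈-++⁺ˡ (M .complete qx)
      to (inj₂ (_ , _ , ≡.refl , ≡.refl , hx)) =
        ∈-++⁺ʳ (M .list n) (∈-prefixed⁺ k (K .list) (K .complete hx))

      from : ∀ {x} → x ∈ M .list n ⊎ x ∈ rest → x ∈ L .list n
      from (inj₁ x∈M)    = L .complete (Q⇒P (M .sound x∈M))
      from (inj₂ x∈rest) with _ , _ , ≡.refl , ≡.refl , x∈K ← ∈-prefixed⁻ k (K .list) n x∈rest =
        L .complete (H⇒P (K .sound x∈K))

-- Partitions and overpartitions with bounded parts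

partitionsEnum : Enumeration IsPartition
partitionsEnum .list         = partitions
partitionsEnum .unique       = partitions-unique
partitionsEnum .sound {n}    = Equivalence.to (∈-partitions n _)
partitionsEnum .complete {n} = Equivalence.from (∈-partitions n _)

overpartitionsEnum : Enumeration IsOverpartition
overpartitionsEnum .list         = overpartitions
overpartitionsEnum .unique       = overpartitions-unique
overpartitionsEnum .sound {n}    = Equivalence.to (∈-overpartitions n _)
overpartitionsEnum .complete {n} = Equivalence.from (∈-overpartitions n _)

-- Linking m in front bounds the first part and hence all parts. The condition also covers the empty
-- partition and survives taking off a first part m.
bounded : (m : ℕ) → Enumeration (λ n ps → IsPartition n ps × Linked _≥_ (m ∷ ps))
bounded m = restrict (λ ps → Linked.linked? ℕₚ._≥?_ (m ∷ ps)) partitionsEnum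

bounded-split : ∀ {m n ps} → IsPartition n ps × Linked _≥_ (suc m ∷ ps) →
  IsPartition n ps × Linked _≥_ (m ∷ ps) ⊎
  ∃[ qs ] ∃[ j ] (ps ≡ suc m ∷ qs × n ≡ suc m ℕ.+ j × IsPartition j qs × Linked _≥_ (suc m ∷ qs))
bounded-split {ps = []}     (π , _)                 = inj₁ (π , [-])
bounded-split {m} {ps = k ∷ qs} (π@(_ ∷ 0< , _ , Σ≡) , k≤ ∷ l) with k ℕₚ.≟ suc m
... | yes ≡.refl = inj₂ (qs , sum qs , ≡.refl , ≡.sym Σ≡ , (0< , Linked.tail l , ≡.refl) , l)
... | no k≢      = inj₁ (π , ℕₚ.≤-pred (ℕₚ.≤∧≢⇒< k≤ k≢) ∷ l)

bounded-0 : ∀ {n ps} → IsPartition n ps × Linked _≥_ (0 ∷ ps) → n ≡ 0 × ps ≡ []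
bounded-0 {ps = []}    ((_ , _ , ≡.refl) , _)      = ≡.refl , ≡.refl
bounded-0 {ps = _ ∷ _} ((0<k ∷ _ , _) , k≤0 ∷ _) = contradiction k≤0 (ℕₚ.<⇒≱ 0<k)

bounded-raise : ∀ {m ps} → Linked _≥_ (m ∷ ps) → Linked _≥_ (suc m ∷ ps)
bounded-raise [-]      = [-]
bounded-raise (k≤ ∷ l) = ℕₚ.m≤n⇒m≤1+n k≤ ∷ l

bounded-prefix : ∀ {m j qs} → IsPartition j qs × Linked _≥_ (suc m ∷ qs) →
  IsPartition (suc m ℕ.+ j) (suc m ∷ qs) × Linked _≥_ (suc m ∷ suc m ∷ qs)
bounded-prefix ((0< , _ , ≡.refl) , l) = (s≤s z≤n ∷ 0< , l , ≡.refl) , ℕₚ.≤-refl ∷ l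

bounded-≥sum : ∀ {m n ps} → n ≤ m → IsPartition n ps → Linked _≥_ (m ∷ ps)
bounded-≥sum {ps = []}     _   _                 = [-]
bounded-≥sum {ps = k ∷ ps} n≤m (_ , l , ≡.refl) = ℕₚ.≤-trans (ℕₚ.m≤m+n k (sum ps)) n≤m ∷ l

overBounded : (m : ℕ) → Enumeration (λ n π → IsOverpartition n π × Linked _≥_ (m ∷ sizes π))
overBounded m = restrict (λ π → Linked.linked? ℕₚ._≥?_ (m ∷ sizes π)) overpartitionsEnum

-- Parts at most m, with no m overlined.
plainBounded : (m : ℕ) → Enumeration (λ n π → IsOverpartition n π × Linked _⊵_ ((m , false) ∷ π))
plainBounded m = restrict (λ π → Linked.linked? _⊵?_ ((m , false) ∷ π)) overpartitionsEnum

-- `_⊵_` does not look at the mark of its left argument.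
relabel : ∀ {m b b′ π} → Linked _⊵_ ((m , b) ∷ π) → Linked _⊵_ ((m , b′) ∷ π)
relabel [-]     = [-]
relabel (p ∷ l) = p ∷ l

sizes-linked : ∀ {π} → Linked _⊵_ π → Linked _≥_ (sizes π)
sizes-linked = Linked.map⁺ ∘ Linked.map proj₁

over-0 : ∀ {n π} → IsOverpartition n π × Linked _≥_ (0 ∷ sizes π) → n ≡ 0 × π ≡ []
over-0 {π = []}    ((_ , _ , ≡.refl) , _)      = ≡.refl , ≡.refl
over-0 {π = _ ∷ _} ((0<k ∷ _ , _) , k≤0 ∷ _) = contradiction k≤0 (ℕₚ.<⇒≱ 0<k)

over-prefix : ∀ {m j b π} → IsOverpartition j π × Linked _⊵_ ((suc m , false) ∷ π) →
  IsOverpartition (suc m ℕ.+ j) ((suc m , b) ∷ π)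
over-prefix ((0< , _ , ≡.refl) , l) = s≤s z≤n ∷ 0< , relabel l , ≡.refl

-- An overlined m + 1 can only be the first part, and any further copies after it are plain. This is
-- the source of the factor 1 + x.
over-split : ∀ {m n π} → IsOverpartition n π × Linked _≥_ (suc m ∷ sizes π) →
  IsOverpartition n π × Linked _⊵_ ((suc m , false) ∷ π) ⊎
  ∃[ ρ ] ∃[ j ] (π ≡ (suc m , true) ∷ ρ × n ≡ suc m ℕ.+ j ×
                 IsOverpartition j ρ × Linked _⊵_ ((suc m , false) ∷ ρ))
over-split {π = []}              (π! , _) = inj₁ (π! , [-])
over-split {π = (k , false) ∷ ρ} (π!@(_ , l , _) , k≤ ∷ _) = inj₁ (π! , (k≤ , λ ()) ∷ l)
over-split {m} {π = (k , true) ∷ ρ} (π!@(_ ∷ 0< , l , Σ≡) , k≤ ∷ _) with k ℕₚ.≟ suc m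
... | yes ≡.refl = inj₂ (ρ , sum (sizes ρ) , ≡.refl , ≡.sym Σ≡ ,
                         (0< , Linked.tail l , ≡.refl) , relabel l)
... | no k≢      = inj₁ (π! , (k≤ , λ _ → ℕₚ.≤∧≢⇒< k≤ k≢) ∷ l)

-- A first part m + 1 is plain here and may be followed by further plain copies, so the same family
-- recurs. This is the source of the factor 1/(1 - x).
plain-split : ∀ {m n π} → IsOverpartition n π × Linked _⊵_ ((suc m , false) ∷ π) →
  IsOverpartition n π × Linked _≥_ (m ∷ sizes π) ⊎
  ∃[ ρ ] ∃[ j ] (π ≡ (suc m , false) ∷ ρ × n ≡ suc m ℕ.+ j ×
                 IsOverpartition j ρ × Linked _⊵_ ((suc m , false) ∷ ρ))
plain-split {π = []} (π! , _) = inj₁ (π! , [-])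
plain-split {m} {π = (k , b) ∷ ρ} (π!@(_ ∷ 0< , l , Σ≡) , (k≤ , ov) ∷ _) with k ℕₚ.≟ suc m
... | no k≢      = inj₁ (π! , ℕₚ.≤-pred (ℕₚ.≤∧≢⇒< k≤ k≢) ∷ sizes-linked l)
plain-split {π = (_ , false) ∷ ρ} ((_ ∷ 0< , l , Σ≡) , _) | yes ≡.refl =
  inj₂ (ρ , sum (sizes ρ) , ≡.refl , ≡.sym Σ≡ , (0< , Linked.tail l , ≡.refl) , l)
plain-split {π = (_ , true) ∷ ρ} (_ , (_ , ov) ∷ _) | yes ≡.refl =
  contradiction (ov _) (ℕₚ.<-irrefl ≡.refl)

plain⇒over : ∀ {m n π} → IsOverpartition n π × Linked _⊵_ ((m , false) ∷ π) →
  IsOverpartition n π × Linked _≥_ (m ∷ sizes π)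
plain⇒over (π! , l) = π! , sizes-linked l

over⇒plain : ∀ {m n π} → IsOverpartition n π × Linked _≥_ (m ∷ sizes π) →
  IsOverpartition n π × Linked _⊵_ ((suc m , false) ∷ π)
over⇒plain {π = []}    (π! , _)               = π! , [-]
over⇒plain {π = _ ∷ _} (π!@(_ , l , _) , k≤ ∷ _) =
  π! , (ℕₚ.m≤n⇒m≤1+n k≤ , λ _ → s≤s k≤) ∷ l

over-≥sum : ∀ {m n π} → n ≤ m → IsOverpartition n π → Linked _≥_ (m ∷ sizes π)
over-≥sum {π = []}          _   _                 = [-]
over-≥sum {π = (k , _) ∷ ρ} n≤m (_ , l , ≡.refl) =
  ℕₚ.≤-trans (ℕₚ.m≤m+n k (sum (sizes ρ))) n≤m ∷ sizes-linked l

-- The statistics r and s when one or two copies of the largest part are removed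

parts≤ : ∀ {m ps} → Linked _≥_ (m ∷ ps) → All (_≤ m) ps
parts≤ l = AllPairs.head (Linked.Linked⇒AllPairs (λ j≥k k≥l → ℕₚ.≤-trans k≥l j≥k) l)

filter-cong-∈ : ∀ {A : Set} {P Q : A → Set} (P? : Unary.Decidable P) (Q? : Unary.Decidable Q) →
  ∀ {xs} → All (λ x → P x ⇔ Q x) xs → filter P? xs ≡ filter Q? xs
filter-cong-∈ P? Q? []                   = ≡.refl
filter-cong-∈ P? Q? {x ∷ xs} (P⇔Q ∷ eqs) with P? x | Q? x
... | yes px | yes qx = ≡.cong (x ∷_) (filter-cong-∈ P? Q? eqs)
... | no _   | no _   = filter-cong-∈ P? Q? eqs
... | yes px | no ¬qx = contradiction (Equivalence.to P⇔Q px) ¬qx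
... | no ¬px | yes qx = contradiction (Equivalence.from P⇔Q qx) ¬px

multiplicity-≢ : ∀ {k p} ps → k ≢ p → multiplicity k (p ∷ ps) ≡ multiplicity k ps
multiplicity-≢ {k} {p} ps k≢p = ≡.cong length (filter-reject (k ℕₚ.≟_) {x = p} {xs = ps} k≢p)

multiplicity-≡ : ∀ p ps → multiplicity p (p ∷ ps) ≡ suc (multiplicity p ps)
multiplicity-≡ p ps = ≡.cong length (filter-accept (p ℕₚ.≟_) {x = p} {xs = ps} ≡.refl)

multiplicity-fresh : ∀ {p ps} → All (p ≢_) ps → multiplicity p ps ≡ 0
multiplicity-fresh {p} fresh = ≡.cong length (filter-none (p ℕₚ.≟_) fresh)

fresh-≢ : ∀ {p} {ps : List ℕ} → All (p ≢_) ps → ∀ {k} → k ∈ ps → k ≢ p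
fresh-≢ fresh k∈ ≡.refl = All.lookup fresh k∈ ≡.refl

<⇒fresh : ∀ {m ps} → Linked _≥_ (m ∷ ps) → All (suc m ≢_) ps
<⇒fresh l = All.map (λ k≤m → ℕₚ.>⇒≢ (s≤s k≤m)) (parts≤ l)

⇔-subst : ∀ {A : Set} (P : A → Set) {x y} → x ≡ y → P x ⇔ P y
⇔-subst P ≡.refl = mk⇔ (λ p → p) (λ p → p)

odd? : ∀ ps → Unary.Decidable (λ k → 2 ∤ multiplicity k ps)
odd? ps k = ¬? (2 ∣? multiplicity k ps)

-- A new size has multiplicity one, so it is filtered out, and it leaves the other multiplicities
-- alone.
r-fresh : ∀ {p ps} → All (p ≢_) ps → r (p ∷ ps) ≡ r ps
r-fresh {p} {ps} fresh = ≡.cong (max 0) (≡.trans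
  (filter-reject (λ k → 2 ℕₚ.≤? multiplicity k (p ∷ ps)) {x = p} {xs = ps} once)
  (filter-cong-∈ (λ k → 2 ℕₚ.≤? multiplicity k (p ∷ ps)) (λ k → 2 ℕₚ.≤? multiplicity k ps)
    (All.tabulate λ k∈ → ⇔-subst (2 ≤_) (multiplicity-≢ ps (fresh-≢ fresh k∈)))))
  where
  once : ¬ 2 ≤ multiplicity p (p ∷ ps)
  once 2≤ with s≤s () ← ≡.subst (2 ≤_)
    (≡.trans (multiplicity-≡ p ps) (≡.cong suc (multiplicity-fresh fresh))) 2≤

r-repeated : ∀ {p ps} → Linked _≥_ (p ∷ ps) → r (p ∷ p ∷ ps) ≡ p
r-repeated {p} {ps} l = max≈v⁺ (∈-filter⁺ twice? (here ≡.refl) twice)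
  (All.filter⁺ twice? (ℕₚ.≤-refl ∷ ℕₚ.≤-refl ∷ parts≤ l)) z≤n
  where
  twice? : Unary.Decidable (λ k → 2 ≤ multiplicity k (p ∷ p ∷ ps))
  twice? k = 2 ℕₚ.≤? multiplicity k (p ∷ p ∷ ps)

  twice : 2 ≤ multiplicity p (p ∷ p ∷ ps)
  twice = ≡.subst (2 ≤_)
    (≡.sym (≡.trans (multiplicity-≡ p (p ∷ ps)) (≡.cong suc (multiplicity-≡ p ps)))) (s≤s (s≤s z≤n))

deduplicate-fresh : ∀ {p} {ps : List ℕ} → All (p ≢_) ps →
  filter (¬? ∘ (p ℕₚ.≟_)) (deduplicate ℕₚ._≟_ ps) ≡ deduplicate ℕₚ._≟_ ps
deduplicate-fresh {p} fresh = filter-all (¬? ∘ (p ℕₚ.≟_)) (All.deduplicate⁺ ℕₚ._≟_ fresh)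

unpaired-fresh : ∀ {p ps} → All (p ≢_) ps → unpaired (p ∷ ps) ≡ p ∷ unpaired ps
unpaired-fresh {p} {ps} fresh = begin
  filter (odd? (p ∷ ps)) (p ∷ filter (¬? ∘ (p ℕₚ.≟_)) (deduplicate ℕₚ._≟_ ps))
    ≡⟨ ≡.cong (λ ks → filter (odd? (p ∷ ps)) (p ∷ ks)) (deduplicate-fresh fresh) ⟩
  filter (odd? (p ∷ ps)) (p ∷ deduplicate ℕₚ._≟_ ps)
    ≡⟨ filter-accept (odd? (p ∷ ps)) {x = p} {xs = deduplicate ℕₚ._≟_ ps} odd ⟩
  p ∷ filter (odd? (p ∷ ps)) (deduplicate ℕₚ._≟_ ps)
    ≡⟨ ≡.cong (p ∷_) (filter-cong-∈ (odd? (p ∷ ps)) (odd? ps) (All.tabulate λ k∈ →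
         ⇔-subst (2 ∤_) (multiplicity-≢ ps (fresh-≢ (All.deduplicate⁺ ℕₚ._≟_ fresh) k∈)))) ⟩
  p ∷ unpaired ps ∎
  where
  open ≡.≡-Reasoning

  odd : 2 ∤ multiplicity p (p ∷ ps)
  odd rewrite multiplicity-≡ p ps | multiplicity-fresh fresh =
    λ 2∣1 → contradiction (∣1⇒≡1 2∣1) λ ()

odd-repeated : ∀ p ps k → (2 ∤ multiplicity k (p ∷ p ∷ ps)) ⇔ (2 ∤ multiplicity k ps)
odd-repeated p ps k with k ℕₚ.≟ p
... | yes ≡.refl rewrite multiplicity-≡ p (p ∷ ps) | multiplicity-≡ p ps =
  mk⇔ (λ 2∤ 2∣ → 2∤ (∣m∣n⇒∣m+n ∣-refl 2∣)) (λ 2∤ 2∣ → 2∤ (∣m+n∣m⇒∣n 2∣ ∣-refl))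
... | no k≢p rewrite multiplicity-≢ (p ∷ ps) k≢p | multiplicity-≢ ps k≢p =
  mk⇔ (λ 2∤ → 2∤) (λ 2∤ → 2∤)

-- Two further copies of p change no parity of a multiplicity. What remains is to compare the
-- deduplicated lists.
unpaired-repeated : ∀ {p ps} → Linked _≥_ (p ∷ ps) → unpaired (p ∷ p ∷ ps) ≡ unpaired ps
unpaired-repeated {p} {ps} l = ≡.trans
  (filter-≐ (odd? (p ∷ p ∷ ps)) (odd? ps)
    ( (λ {k} → Equivalence.to (odd-repeated p ps k))
    , (λ {k} → Equivalence.from (odd-repeated p ps k))) _)
  (≡.trans (≡.cong (filter (odd? ps) ∘ (p ∷_)) (remove-again (deduplicate ℕₚ._≟_ ps))) (drop l))
  where
  ≢p? : Unary.Decidable (p ≢_)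
  ≢p? = ¬? ∘ (p ℕₚ.≟_)

  remove-again : ∀ ks → filter ≢p? (p ∷ filter ≢p? ks) ≡ filter ≢p? ks
  remove-again ks = ≡.trans
    (filter-reject ≢p? {x = p} {xs = filter ≢p? ks} (λ p≢p → p≢p ≡.refl)) (filter-idem ≢p? ks)

  -- If p occurs in `ps` it is the first part, and deduplication absorbs the extra copy. Otherwise
  -- its multiplicity in `ps` is 0, which is even, and the filter discards it.
  drop : ∀ {ps} → Linked _≥_ (p ∷ ps) →
    filter (odd? ps) (p ∷ filter ≢p? (deduplicate ℕₚ._≟_ ps)) ≡ unpaired ps
  drop [-] = ≡.refl
  drop {ps = k ∷ ps} (k≤p ∷ l) with k ℕₚ.≟ p
  ... | yes ≡.refl =
          ≡.cong (filter (odd? (p ∷ ps)) ∘ (p ∷_)) (remove-again (deduplicate ℕₚ._≟_ ps))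
  ... | no k≢p = ≡.trans
          (≡.cong (filter (odd? (k ∷ ps)) ∘ (p ∷_)) (deduplicate-fresh fresh))
          (filter-reject (odd? (k ∷ ps)) {x = p} {xs = deduplicate ℕₚ._≟_ (k ∷ ps)} λ 2∤ →
            2∤ (≡.subst (2 ∣_) (≡.sym (multiplicity-fresh fresh)) (2 ∣0)))
    where
    fresh : All (p ≢_) (k ∷ ps)
    fresh = (k≢p ∘ ≡.sym) ∷ All.map (λ { j≤k ≡.refl → k≢p (ℕₚ.≤-antisym k≤p j≤k) }) (parts≤ l)

s-fresh : ∀ {p ps} → All (p ≢_) ps → s (p ∷ ps) ≡ p ∸ s ps
s-fresh fresh = ≡.cong alternatingSum (unpaired-fresh fresh)

s-repeated : ∀ {p ps} → Linked _≥_ (p ∷ ps) → s (p ∷ p ∷ ps) ≡ s ps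
s-repeated l = ≡.cong alternatingSum (unpaired-repeated l)

-- Recurrences of the generating functions and the quotient identity

module QuotientIdentity {c ℓ} (R : CommutativeRing c ℓ) where
  open CommutativeRing R hiding (zero)
  open ExpProperties commutativeSemiring using (_^_)
  open PowerSeries R
  open GeneratingFunctions R
  open SeriesProperties R
  open SumProperties R
  open RingProperties ring using (-0#≈0#)

  weight : Carrier → Carrier → ℕ → Carrier
  weight y z k = if does (2 ∣? k) then y else z

  monomial : Carrier → Carrier → List Part → Carrier
  monomial y z π = y ^ e π * z ^ o π

  monomial-∷ : ∀ y z k b π → monomial y z ((k , b) ∷ π) ≈ weight y z k * monomial y z π
  monomial-∷ y z k b π with does (2 ∣? k)
  ... | true  = *-assoc y (y ^ e π) (z ^ o π)
  ... | false = trans (sym (*-assoc (y ^ e π) z (z ^ o π)))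
                  (trans (*-congʳ (*-comm (y ^ e π) z)) (*-assoc z (y ^ e π) (z ^ o π)))

  weight-even : ∀ y z {k} → 2 ∣ k → weight y z k ≡ y
  weight-even y z {k} 2∣k = ≡.cong (if_then y else z) (dec-true (2 ∣? k) 2∣k)

  weight-odd : ∀ y z {k} → 2 ∤ k → weight y z k ≡ z
  weight-odd y z {k} 2∤k = ≡.cong (if_then y else z) (dec-false (2 ∣? k) 2∤k)

  2∤1+2* : ∀ j → 2 ∤ 1 ℕ.+ 2 ℕ.* j
  2∤1+2* j 2∣ = contradiction
    (∣1⇒≡1 (∣m+n∣m⇒∣n (≡.subst (2 ∣_) (ℕₚ.+-comm 1 (2 ℕ.* j)) 2∣) (m∣m*n j))) λ ()

  module Truncation (N : ℕ) where
    private module S = CommutativeRing (truncated N)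
    open S using () renaming (_≈_ to _≈ₛ_; -_ to ⊖_)
    open ExpProperties S.commutativeSemiring using () renaming (_^_ to _^ₛ_)
    open NilpotentVariable (truncated N) q N (q^1+N≈0 N)

    partitionSum : ℕ → (List ℕ → Carrier) → Series
    partitionSum m f n = sumOver (bounded m .list n) f

    partitionSum-cong : ∀ m {f g} →
      (∀ {n ps} → IsPartition n ps × Linked _≥_ (m ∷ ps) → f ps ≈ g ps) →
      partitionSum m f ≈ₛ partitionSum m g
    partitionSum-cong m f≈g {n} _ = sumOver-cong (bounded m .list n) (f≈g ∘ bounded m .sound {n})

    partitionSum-suc : ∀ m f → partitionSum (suc m) f ≈ₛ
      partitionSum m f ⊕ q ^ₛ suc m ⊛ partitionSum (suc m) (f ∘ (suc m ∷_))
    partitionSum-suc m f {n} _ = trans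
      (sumOver-head (bounded (suc m)) (bounded m) (bounded (suc m)) (suc m) (suc m)
        bounded-split
        (λ (π! , l) → π! , bounded-raise l)
        bounded-prefix
        (λ { (_ , k≤m ∷ _) → ℕₚ.<-irrefl ≡.refl k≤m })
        f n)
      (+-congˡ (sym (q^-⊛ N (suc m) _ n)))

    partitionSum-0 : ∀ f → partitionSum 0 f ≈ₛ const (f [])
    partitionSum-0 f {n} _ =
      sumOver-empty (bounded 0) (([] , [] , ≡.refl) , [-]) bounded-0 f n

    -- The weights are arbitrary functions because removing a single largest part m replaces `φ` by
    -- its reflection `φ ∘ (m ∸_)`, which leaves the family of powers of z.
    rankSum : ℕ → (ℕ → Carrier) → (ℕ → Carrier) → Series
    rankSum m ψ φ = partitionSum m (λ ps → ψ (r ps) * φ (s ps))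

    partitionSum-* : ∀ m a f → partitionSum m (λ ps → a * f ps) ≈ₛ const a ⊛ partitionSum m f
    partitionSum-* m a f {n} _ = trans (sumOver-* (bounded m .list n) a f)
      (sym (const-⊛ a (partitionSum m f) n))

    -- The part m + 1 is absent, occurs once, or occurs at least twice. Once, it keeps r and
    -- reflects s. Twice or more, it fixes r = m + 1, and removing two copies keeps s.
    rankSum-suc : ∀ m ψ φ → rankSum (suc m) ψ φ ≈ₛ
      rankSum m ψ φ ⊕
      q ^ₛ suc m ⊛ (rankSum m ψ (φ ∘ (suc m ∸_)) ⊕
                    q ^ₛ suc m ⊛ (const (ψ (suc m)) ⊛ rankSum (suc m) (λ _ → 1#) φ))
    rankSum-suc m ψ φ = S.trans (partitionSum-suc m f)
      (S.+-congˡ {x = rankSum m ψ φ} (S.*-congˡ {x = q ^ₛ suc m}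
        (S.trans (partitionSum-suc m (f ∘ (suc m ∷_))) (S.+-cong
          (partitionSum-cong m λ (_ , l) → reflexive (≡.cong₂ (λ a b → ψ a * φ b)
            (r-fresh (<⇒fresh l)) (s-fresh (<⇒fresh l))))
          (S.*-congˡ {x = q ^ₛ suc m} (S.trans
            (partitionSum-cong (suc m) λ (_ , l) → trans
              (reflexive (≡.cong₂ (λ a b → ψ a * φ b) (r-repeated l) (s-repeated l)))
              -- The inserted factor 1 makes the remaining sum a `rankSum` with constant first
              -- weight.
              (*-congˡ (sym (*-identityˡ _))))
            (partitionSum-* (suc m) (ψ (suc m)) _)))))))
      where
      f : List ℕ → Carrier
      f ps = ψ (r ps) * φ (s ps)

    rankSum-1 : ∀ m φ → rankSum m (λ _ → 1#) φ ≈ₛ even m ⊛ distinct m (const ∘ φ)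
    rankSum-1 zero    φ = S.trans (partitionSum-0 _) λ {n} _ → const-* 1# (φ 0) n
    rankSum-1 (suc m) φ = even-distinct-suc m (const ∘ φ) (S.trans (rankSum-suc m (λ _ → 1#) φ)
      (S.+-cong (rankSum-1 m φ) (S.*-congˡ {x = q ^ₛ suc m} (S.+-cong
        (rankSum-1 m (φ ∘ (suc m ∸_)))
        (S.*-congˡ {x = q ^ₛ suc m} (S.*-identityˡ (rankSum (suc m) (λ _ → 1#) φ)))))))

    -- The case of two or more copies no longer involves r and is already evaluated by `rankSum-1`,
    -- so plain induction on m suffices.
    rankSum-^ : ∀ y m φ →
      rankSum m (y ^_) φ ≈ₛ euler (p ⊛ const y) m ⊛ distinct m (const ∘ φ)
    rankSum-^ y zero    φ = S.trans (partitionSum-0 _) λ {n} _ → const-* 1# (φ 0) n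
    rankSum-^ y (suc m) φ = S.trans (rankSum-suc m (y ^_) φ) (S.trans
      (S.+-cong (rankSum-^ y m φ) (S.*-congˡ {x = q ^ₛ suc m} (S.+-cong
        (rankSum-^ y m (φ ∘ (suc m ∸_)))
        (S.*-congˡ {x = q ^ₛ suc m}
          (S.*-cong (λ {n} _ → const-^ N y (suc m) n) (rankSum-1 (suc m) φ))))))
      (euler-distinct-suc (const y) m (const ∘ φ)))

    𝒥-product : ∀ y z → 𝒥 y z ≈ₛ eulerProduct (p ⊛ const y) (q ⊛ const z)
    𝒥-product y z = S.trans
      (λ {n} n≤N → sumOver-unique partitionsEnum (bounded N) n
        (λ π! → π! , bounded-≥sum n≤N π!) proj₁ _)
      (S.trans (rankSum-^ y N (z ^_)) (S.*-congˡ {x = euler (p ⊛ const y) N} (S.trans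
        (distinct-cong N (λ {k} _ {n} _ → const-^ N z k n))
        (distinct-rogersSzegő (const z) N))))

    module _ (y z : Carrier) where

      overSum plainSum : ℕ → Series
      overSum  m n = sumOver (overBounded m .list n) (monomial y z)
      plainSum m n = sumOver (plainBounded m .list n) (monomial y z)

      prefix-sum : ∀ m b n →
        shift (suc m)
          (λ j → sumOver (plainBounded (suc m) .list j) (monomial y z ∘ ((suc m , b) ∷_))) n ≈
        (q ^ₛ suc m ⊛ (const (weight y z (suc m)) ⊛ plainSum (suc m))) n
      prefix-sum m b n = sym (trans (q^-⊛ N (suc m) _ n) (shift-cong (suc m) (λ j → sym (trans
        (trans (sumOver-cong (plainBounded (suc m) .list j) λ {π} _ → monomial-∷ y z (suc m) b π)
               (sumOver-* (plainBounded (suc m) .list j) (weight y z (suc m)) (monomial y z)))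
        (sym (const-⊛ (weight y z (suc m)) (plainSum (suc m)) j)))) n))

      overSum-suc : ∀ m → overSum (suc m) ≈ₛ
        plainSum (suc m) ⊕ q ^ₛ suc m ⊛ (const (weight y z (suc m)) ⊛ plainSum (suc m))
      overSum-suc m {n} _ = trans
        (sumOver-head (overBounded (suc m)) (plainBounded (suc m)) (plainBounded (suc m))
          (suc m , true) (suc m) over-split plain⇒over
          (λ h → over-prefix h , ℕₚ.≤-refl ∷ sizes-linked (proj₂ h))
          (λ { (_ , (_ , ov) ∷ _) → ℕₚ.<-irrefl ≡.refl (ov _) })
          (monomial y z) n)
        (+-congˡ (prefix-sum m true n))

      plainSum-suc : ∀ m → plainSum (suc m) ≈ₛ
        overSum m ⊕ q ^ₛ suc m ⊛ (const (weight y z (suc m)) ⊛ plainSum (suc m))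
      plainSum-suc m {n} _ = trans
        (sumOver-head (plainBounded (suc m)) (overBounded m) (plainBounded (suc m))
          (suc m , false) (suc m) plain-split over⇒plain
          (λ h → over-prefix h , (ℕₚ.≤-refl , λ ()) ∷ proj₂ h)
          (λ { (_ , k≤m ∷ _) → ℕₚ.<-irrefl ≡.refl k≤m })
          (monomial y z) n)
        (+-congˡ (prefix-sum m false n))

      overpartition-product : overpartitionSeries y z ⊛ 𝒥 (- y) (- z) ≈ₛ 𝒥 y z
      overpartition-product = S.trans
        (S.*-cong
          -- The bound is 2N because the telescoping runs through N pairs of an odd and an even
          -- size. Any bound of at least N loses nothing in degrees up to N.
          (λ {n} n≤N → sumOver-unique overpartitionsEnum (overBounded (2 ℕ.* N)) n
            (λ π! → π! , over-≥sum (ℕₚ.≤-trans n≤N (ℕₚ.m≤m+n N _)) π!) proj₁ (monomial y z))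
          (S.trans (𝒥-product (- y) (- z))
            (eulerProduct-cong
              (S.*-congˡ {x = p} (const-neg y)) (S.*-congˡ {x = q} (const-neg z)))))
        (S.trans
          (overpartition-quotient (const y) (const z) overSum plainSum (const ∘ weight y z)
            overSum-0 overSum-suc plainSum-suc
            (λ j → S.reflexive (≡.cong const (weight-odd y z (2∤1+2* j))))
            (λ j → S.reflexive (≡.cong const (weight-even y z (∣m∣n⇒∣m+n ∣-refl (m∣m*n j))))))
          (S.sym (𝒥-product y z)))
        where
        const-neg : ∀ a → const (- a) ≈ₛ ⊖ const a
        const-neg a {zero}  _ = refl
        const-neg a {suc n} _ = sym -0#≈0#

        overSum-0 : overSum 0 ≈ₛ const 1#
        overSum-0 {n} _ = trans
          (sumOver-empty (overBounded 0) (([] , [] , ≡.refl) , [-]) over-0 (monomial y z) n)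
          (const-cong n)
          where
          const-cong : ∀ n → const (1# * 1#) n ≈ const 1# n
          const-cong zero    = *-identityʳ 1#
          const-cong (suc n) = refl

  quotient-identity : ∀ y z →
    overpartitionSeries y z ≋ 𝒥 y z / 𝒥 (- y) (- z) ⟨ 𝒥₀≈1 (- y) (- z) ⟩
  quotient-identity y z = /-unique (𝒥 y z) (𝒥 (- y) (- z)) (𝒥₀≈1 (- y) (- z))
    -- Coefficient n is read off from the truncation at N = n.
    (overpartitionSeries y z) λ n → Truncation.overpartition-product n y z ℕₚ.≤-refl

open import Defs

theorem5p1 : let open CommutativeRing ℤ[y,z] using (-_) in
    overpartitionSeries y z ≋ 𝒥 y z / 𝒥 (- y) (- z) ⟨ 𝒥₀≈1 (- y) (- z) ⟩
theorem5p1 = QuotientIdentity.quotient-identity ℤ[y,z] y z
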